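{- Let $X$ be a real such that for every uniformly computable sequence $\mathbb{X}=\langle X_i\rangle$ of computable reals (not all empty), $X$ computes a function $f$ that is FIP with respect to $\mathbb{X}$. Then $X$ computes a Cohen 1-generic real.
   Context: Reals are subsets of $\mathbb{N}$. A family of reals has the finite intersection property if every finite subfamily has nonempty intersection. A function $f:\mathbb{N}\to\mathbb{N}$ is FIP with respect to $\mathbb{X}=\langle X_i\rangle$ if $\{X_{f(i)} : i<\omega\}$ has the finite intersection property and whenever $\{X_{f(i)}\}\subsetneq\{X_{g(i)}\}$ for some $g:\mathbb{N}\to\mathbb{N}$, the family $\{X_{g(i)}\}$ does not have the finite intersection property. A real $G$ is Cohen 1-generic if for every c.e. set $V\subseteq 2^{<\omega}$ there is $\tau\prec G$ such that either $\tau\in V$ or no extension of $\tau$ lies in $V$. -}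

module Defs where

open import Data.Nat using (ℕ; zero; suc; _+_; _∸_)
open import Data.Bool using (Bool; true; false; if_then_else_)
open import Data.Maybe using (Maybe; just; nothing; _>>=_)
open import Data.Product using (Σ; ∃; ∃-syntax; _×_; _,_; proj₁; proj₂)
open import Data.Sum using (_⊎_)
open import Data.List using (List; []; _∷_; _++_; [_])
open import Data.List.Relation.Unary.All using (All)
open import Relation.Binary.PropositionalEquality using (_≡_)
open import Relation.Nullary using (¬_)

-- Reals are subsets of ℕ, given by characteristic functions.

Real : Set
Real = ℕ → Bool

bit : Bool → ℕ
bit true  = 1
bit false = 0

∅ : Real
∅ _ = false

-- Cantor pairing (diagonal enumeration of ℕ × ℕ).

tri : ℕ → ℕ
tri zero    = zero
tri (suc k) = suc k + tri k

pair : ℕ → ℕ → ℕ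
pair a b = tri (a + b) + b

unpair : ℕ → ℕ × ℕ
unpair zero = (0 , 0)
unpair (suc n) with unpair n
... | (zero  , b) = (suc b , 0)
... | (suc a , b) = (a , suc b)

-- Oracle μ-recursive functions (unary, via pairing): codes.

data Code : Set where
  zer  : Code
  scc  : Code
  idc  : Code
  orc  : Code
  fstc : Code
  sndc : Code
  pairc : Code → Code → Code
  comp : Code → Code → Code
  prec : Code → Code → Code
  mu   : Code → Code

search : ℕ → (ℕ → Maybe ℕ) → ℕ → Maybe ℕ
search zero    h n = nothing
search (suc b) h n with h n
... | nothing      = nothing
... | just zero    = just n
... | just (suc _) = search b h (suc n)

-- Evaluation with fuel: eval s e X x ≡ just y means Φ_e^X(x) ↓ = y
-- (within fuel s).
eval : ℕ → Code → Real → ℕ → Maybe ℕ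
eval zero    _           _ _ = nothing
eval (suc k) zer         O x = just 0
eval (suc k) scc         O x = just (suc x)
eval (suc k) idc         O x = just x
eval (suc k) orc         O x = just (bit (O x))
eval (suc k) fstc        O x = just (proj₁ (unpair x))
eval (suc k) sndc        O x = just (proj₂ (unpair x))
eval (suc k) (pairc f g) O x =
  eval k f O x >>= λ a → eval k g O x >>= λ b → just (pair a b)
eval (suc k) (comp f g)  O x = eval k g O x >>= eval k f O
eval (suc k) (prec f g)  O x with unpair x
... | (zero  , y) = eval k f O y
... | (suc n , y) =
  eval k (prec f g) O (pair n y) >>= λ h → eval k g O (pair n (pair h (y)))
eval (suc k) (mu f)      O x = search k (λ n → eval k f O (pair n x)) 0

_⊢_⇓_↦_ : Real → Code → ℕ → ℕ → Set
X ⊢ e ⇓ x ↦ y = ∃[ s ] eval s e X x ≡ just y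

_⊢_⇓_ : Real → Code → ℕ → Set
X ⊢ e ⇓ x = ∃[ y ] (X ⊢ e ⇓ x ↦ y)

ComputesFun : Real → (ℕ → ℕ) → Set
ComputesFun X f = ∃[ e ] (∀ n → X ⊢ e ⇓ n ↦ f n)

ComputesReal : Real → Real → Set
ComputesReal X G = ∃[ e ] (∀ n → X ⊢ e ⇓ n ↦ bit (G n))

UniformlyComputable : (ℕ → Real) → Set
UniformlyComputable 𝕏 = ∃[ e ] (∀ i n → ∅ ⊢ e ⇓ pair i n ↦ bit (𝕏 i n))

NotAllEmpty : (ℕ → Real) → Set
NotAllEmpty 𝕏 = ∃[ i ] ∃[ n ] 𝕏 i n ≡ true

HasFIP : (ℕ → Real) → Set
HasFIP F = ∀ (l : List ℕ) → ∃[ m ] All (λ i → F i m ≡ true) l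

_≐_ : Real → Real → Set
A ≐ B = ∀ n → A n ≡ B n

FamSub : (ℕ → Real) → (ℕ → Real) → Set
FamSub F H = ∀ i → ∃[ j ] (F i ≐ H j)

FamProperSub : (ℕ → Real) → (ℕ → Real) → Set
FamProperSub F H = FamSub F H × ¬ FamSub H F

IsFIP : (ℕ → Real) → (ℕ → ℕ) → Set
IsFIP 𝕏 f =
  HasFIP (λ i → 𝕏 (f i)) ×
  (∀ (g : ℕ → ℕ) → FamProperSub (λ i → 𝕏 (f i)) (λ i → 𝕏 (g i))
                 → ¬ HasFIP (λ i → 𝕏 (g i)))

codeStr : List Bool → ℕ
codeStr []      = 0
codeStr (b ∷ σ) = suc (pair (bit b) (codeStr σ))

IsCE : (List Bool → Set) → Set
IsCE V = ∃[ e ] (∀ σ → (V σ → ∅ ⊢ e ⇓ codeStr σ) × (∅ ⊢ e ⇓ codeStr σ → V σ))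

_↾_ : Real → ℕ → List Bool
G ↾ zero  = []
G ↾ suc n = (G ↾ n) ++ [ G n ]

_≺_ : List Bool → Real → Set
τ ≺ G = ∃[ n ] τ ≡ G ↾ n

Cohen1Generic : Real → Set₁
Cohen1Generic G =
  ∀ (V : List Bool → Set) → IsCE V →
    ∃[ τ ] (τ ≺ G × (V τ ⊎ (∀ (ρ : List Bool) → ¬ V (τ ++ ρ))))

{-# OPTIONS --safe #-}
module Submission where

open import Defs
open import Data.Nat using (ℕ)
open import Data.Product using (∃-syntax; _×_)
open import Axiom.ExcludedMiddle using (ExcludedMiddle)
open import Level using (0ℓ)
open import Data.Bool using (Bool; true; false)
open import Data.List using (List; []; _∷_; _++_; [_]; length)
open import Data.List.Relation.Unary.All as All using (All; []; _∷_)
open import Data.List.Relation.Unary.All.Properties using (++⁺; ++⁻ˡ; ++⁻ʳ)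
open import Data.Maybe using (Maybe; just; _>>=_)
open import Data.Nat using
  (zero; suc; pred; _+_; _*_; _∸_; _⊔_; _≤_; _<_; z≤n; s≤s; _≤′_; ≤′-refl; ≤′-step)
open import Data.Nat.Properties
open import Data.Product using (_,_; proj₁; proj₂)
open import Data.Sum using (_⊎_; inj₁; inj₂)
open import Relation.Binary.PropositionalEquality hiding ([_])
open import Relation.Nullary using (¬_; yes; no; contradiction)

-- Let the c.e. family consist of all sets "the n-th bit is b" and "some initial segment lies in
-- the c.e. set W" of pairs of a string and a stage. The bits asked for by a maximal family form
-- a real P ≤ X. If P meets every W in the family, P is 1-generic, since a c.e. set that is dense
-- along P may be added. Otherwise fix W in the family not met by P, and for a Σ₁ question x let
-- W_x be the part of W enumerated before x is answered positively. If x fails, W_x = W is in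
-- the family; if x holds, W_x is finite and not met by P, so it is not. Hence X enumerates the
-- false Σ₁ questions and builds a 1-generic real by finite extension.

-- Elements carry a stage because the sets must be uniformly computable while membership in W is
-- only c.e. Membership of a set in the maximal family is in turn only enumerable from X, so X
-- decides by waiting for one of two events. For the n-th bit, one of the two sets always enters.
-- For a question x, a positive answer shows up as a witness and a negative one as the entry of W_x;
-- the questions asked are whether a given string has an extension in a given c.e. set. W_x cannot
-- enter when x has a witness w: its elements are then recognized from fewer than w bits, and the
-- bit sets force some element of W_x to agree with P that far, so P itself would be met. The
-- argument is not uniform: which of the two reals is taken, and which W serves as the guard, is
-- settled by excluded middle.

suc-pair-suc : ∀ a b → suc (pair (suc a) b) ≡ pair a (suc b)
suc-pair-suc a b rewrite +-suc a b = sym (+-suc _ b)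

suc-pair-zero : ∀ b → suc (pair 0 b) ≡ pair (suc b) 0
suc-pair-zero b rewrite +-identityʳ b | +-identityʳ (b + tri b) = cong suc (+-comm (tri b) b)

-- `unpair` recurses on the code, so the induction is on `n` with the pair free. The two equations
-- above are the two kinds of step along the antidiagonals.
unpair-≡ : ∀ n {a b} → pair a b ≡ n → unpair n ≡ (a , b)
unpair-≡ zero {zero} {zero} _ = refl
unpair-≡ zero {zero} {suc b} ()
unpair-≡ zero {suc a} {b} ()
unpair-≡ (suc n) {zero} {zero} ()
unpair-≡ (suc n) {suc a} {zero} eq
  rewrite unpair-≡ n {0} {a} (suc-injective (trans (suc-pair-zero a) eq)) = refl
unpair-≡ (suc n) {a} {suc b} eq
  rewrite unpair-≡ n {suc a} {b} (suc-injective (trans (suc-pair-suc a b) eq)) = refl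

unpair-pair : ∀ a b → unpair (pair a b) ≡ (a , b)
unpair-pair a b = unpair-≡ (pair a b) refl

-- Sealed copies of `pair` and `unpair`: below, almost only the projection laws matter, and the two
-- equations with `pair` and `unpair` connect them to `eval`.
opaque
  ⟨_,_⟩ : ℕ → ℕ → ℕ
  ⟨ a , b ⟩ = pair a b

  π₁ π₂ : ℕ → ℕ
  π₁ n = proj₁ (unpair n)
  π₂ n = proj₂ (unpair n)

  ⟨,⟩≡pair : ∀ a b → ⟨ a , b ⟩ ≡ pair a b
  ⟨,⟩≡pair a b = refl

  unpair≡π : ∀ n → unpair n ≡ (π₁ n , π₂ n)
  unpair≡π n = refl

  π₁-⟨,⟩ : ∀ a b → π₁ ⟨ a , b ⟩ ≡ a
  π₁-⟨,⟩ a b = cong proj₁ (unpair-pair a b)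

  π₂-⟨,⟩ : ∀ a b → π₂ ⟨ a , b ⟩ ≡ b
  π₂-⟨,⟩ a b = cong proj₂ (unpair-pair a b)

-- Monotonicity in the fuel and fuel-free evaluation rules

>>=-just : ∀ {A B : Set} (m : Maybe A) {k : A → Maybe B} {y} → (m >>= k) ≡ just y →
           ∃[ a ] (m ≡ just a × k a ≡ just y)
>>=-just (just a) eq = a , refl , eq

-- For `mu` the fuel bounds both the number of tests and each single test, so both grow together.
search-mono : ∀ b {h h′ : ℕ → Maybe ℕ} → (∀ n {y} → h n ≡ just y → h′ n ≡ just y) →
              ∀ n {y} → search b h n ≡ just y → search (suc b) h′ n ≡ just y
search-mono (suc b) {h} {h′} le n eq with h n in hn
... | just zero rewrite le n hn = eq
... | just (suc _) rewrite le n hn = search-mono b le (suc n) eq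

eval-suc : ∀ k e {O x y} → eval k e O x ≡ just y → eval (suc k) e O x ≡ just y
eval-suc (suc k) zer eq = eq
eval-suc (suc k) scc eq = eq
eval-suc (suc k) idc eq = eq
eval-suc (suc k) orc eq = eq
eval-suc (suc k) fstc eq = eq
eval-suc (suc k) sndc eq = eq
eval-suc (suc k) (pairc f g) {O} {x} eq
  with a , fa , eq′ ← >>=-just (eval k f O x) eq
  with b , gb , eq″ ← >>=-just (eval k g O x) eq′
  rewrite eval-suc k f fa | eval-suc k g gb = eq″
eval-suc (suc k) (comp f g) {O} {x} eq
  with a , ga , fa ← >>=-just (eval k g O x) eq
  rewrite eval-suc k g ga = eval-suc k f fa
eval-suc (suc k) (prec f g) {O} {x} eq with unpair x
... | zero , y = eval-suc k f eq
... | suc n , y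
  with h , ph , gh ← >>=-just (eval k (prec f g) O (pair n y)) eq
  rewrite eval-suc k (prec f g) ph = eval-suc k g gh
eval-suc (suc k) (mu f) {O} {x} eq =
  search-mono k (λ n → eval-suc k f {x = pair n x}) 0 eq

eval-mono : ∀ {k l} e {O x y} → k ≤ l → eval k e O x ≡ just y → eval l e O x ≡ just y
eval-mono e {O} {x} {y} k≤l = go (≤⇒≤′ k≤l)
  where
  go : ∀ {k l} → k ≤′ l → eval k e O x ≡ just y → eval l e O x ≡ just y
  go ≤′-refl eq = eq
  go (≤′-step k≤l) eq = eval-suc _ e (go k≤l eq)

module _ {O : Real} where

  ↦-pair : ∀ {f g x a b} → O ⊢ f ⇓ x ↦ a → O ⊢ g ⇓ x ↦ b → O ⊢ pairc f g ⇓ x ↦ ⟨ a , b ⟩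
  ↦-pair {f} {g} {x} {a} {b} (s , p) (t , q) = suc (s ⊔ t) , eq
    where
    eq : eval (suc (s ⊔ t)) (pairc f g) O x ≡ just ⟨ a , b ⟩
    eq rewrite eval-mono f (m≤m⊔n s t) p | eval-mono g (m≤n⊔m s t) q | ⟨,⟩≡pair a b = refl

  ↦-comp : ∀ {f g x y z} → O ⊢ g ⇓ x ↦ y → O ⊢ f ⇓ y ↦ z → O ⊢ comp f g ⇓ x ↦ z
  ↦-comp {f} {g} {x} {y} {z} (s , p) (t , q) = suc (s ⊔ t) , eq
    where
    eq : eval (suc (s ⊔ t)) (comp f g) O x ≡ just z
    eq rewrite eval-mono g (m≤m⊔n s t) p = eval-mono f (m≤n⊔m s t) q

  ↦-prec-zero : ∀ {f g x y z} → unpair x ≡ (0 , y) → O ⊢ f ⇓ y ↦ z → O ⊢ prec f g ⇓ x ↦ z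
  ↦-prec-zero {f} {g} {x} {y} {z} x≡ (s , p) = suc s , eq
    where
    eq : eval (suc s) (prec f g) O x ≡ just z
    eq rewrite x≡ = p

  ↦-prec-suc : ∀ {f g x n y h z} → unpair x ≡ (suc n , y) → O ⊢ prec f g ⇓ ⟨ n , y ⟩ ↦ h →
               O ⊢ g ⇓ ⟨ n , ⟨ h , y ⟩ ⟩ ↦ z → O ⊢ prec f g ⇓ x ↦ z
  ↦-prec-suc {f} {g} {x} {n} {y} {h} {z} x≡ (s , p) (t , q)
    rewrite ⟨,⟩≡pair n y | ⟨,⟩≡pair h y | ⟨,⟩≡pair n (pair h y) = suc (s ⊔ t) , eq
    where
    eq : eval (suc (s ⊔ t)) (prec f g) O x ≡ just z
    eq rewrite x≡ | eval-mono (prec f g) (m≤m⊔n s t) p = eval-mono g (m≤n⊔m s t) q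

  search-finds : ∀ {h : ℕ → Maybe ℕ} {n} d m b → d + m ≡ n → d < b →
                 (∀ i → i < n → ∃[ w ] h i ≡ just (suc w)) → h n ≡ just 0 →
                 search b h m ≡ just n
  search-finds zero m (suc b) refl _ below here rewrite here = refl
  search-finds {h} {n} (suc d) m (suc b) eq (s≤s d<b) below here
    with w , hm ← below m (subst (m <_) eq (s≤s (m≤n+m m d))) rewrite hm =
    search-finds d (suc m) b (trans (+-suc d m) eq) d<b below here

  -- All tests of one `mu` search share the same fuel; finitely many terminating tests have a common
  -- bound.
  fuel-below : ∀ {f x} n → (∀ i → i < n → ∃[ w ] O ⊢ f ⇓ ⟨ i , x ⟩ ↦ suc w) →
               ∃[ s ] (∀ i → i < n → ∃[ w ] eval s f O (pair i x) ≡ just (suc w))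
  fuel-below zero below = 0 , λ _ ()
  fuel-below {f} {x} (suc n) below
    with s , bs ← fuel-below n (λ i i<n → below i (m<n⇒m<1+n i<n))
       | w , t , p ← below n ≤-refl = s ⊔ t , λ i i<1+n → case-< i (m≤n⇒m<n∨m≡n (≤-pred i<1+n))
    where
    case-< : ∀ i → i < n ⊎ i ≡ n → ∃[ w ] eval (s ⊔ t) f O (pair i x) ≡ just (suc w)
    case-< i (inj₁ i<n) = _ , eval-mono f (m≤m⊔n s t) (proj₂ (bs i i<n))
    case-< i (inj₂ refl) rewrite ⟨,⟩≡pair n x = w , eval-mono f (m≤n⊔m s t) p

  ↦-mu : ∀ {f x} n → (∀ i → i < n → ∃[ w ] O ⊢ f ⇓ ⟨ i , x ⟩ ↦ suc w) →
         O ⊢ f ⇓ ⟨ n , x ⟩ ↦ 0 → O ⊢ mu f ⇓ x ↦ n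
  ↦-mu {f} {x} n below (t , p) with s , bs ← fuel-below n below rewrite ⟨,⟩≡pair n x =
    suc k , search-finds n 0 k (+-identityʳ n) (m≤n⊔m (s ⊔ t) (suc n))
      (λ i i<n → _ , eval-mono f (≤-trans (m≤m⊔n s t) (m≤m⊔n (s ⊔ t) (suc n))) (proj₂ (bs i i<n)))
      (eval-mono f (≤-trans (m≤n⊔m s t) (m≤m⊔n (s ⊔ t) (suc n))) p)
    where
    -- Enough fuel for every test, and at least the `suc n` tests at 0 to `n`.
    k = (s ⊔ t) ⊔ suc n

-- Closure properties of computable functions

record Computable (O : Real) (f : ℕ → ℕ) : Set where
  constructor computable
  field
    code : Code
    runs : ∀ n → O ⊢ code ⇓ n ↦ f n
open Computable

computes-fun : ∀ {O f} → Computable O f → ComputesFun O f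
computes-fun (computable e r) = e , r

Computable₂ : Real → (ℕ → ℕ → ℕ) → Set
Computable₂ O f = Computable O (λ n → f (π₁ n) (π₂ n))

Computable₃ : Real → (ℕ → ℕ → ℕ → ℕ) → Set
Computable₃ O f = Computable₂ O (λ a n → f a (π₁ n) (π₂ n))

ifz : ℕ → ℕ → ℕ → ℕ
ifz zero    x y = x
ifz (suc _) x y = y

dist : ℕ → ℕ → ℕ
dist m n = (m ∸ n) + (n ∸ m)

-- Throughout, a relation is given by an ℕ-valued function that vanishes exactly when the
-- relation holds, so that + is conjunction, * disjunction and `not` negation.
not : ℕ → ℕ
not n = ifz n 1 0

rec : (ℕ → ℕ) → (ℕ → ℕ → ℕ → ℕ) → ℕ → ℕ → ℕ
rec b s zero    y = b y
rec b s (suc n) y = s n (rec b s n y) y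

exists≤ : (ℕ → ℕ → ℕ) → ℕ → ℕ → ℕ
exists≤ p zero    y = p 0 y
exists≤ p (suc m) y = exists≤ p m y * p (suc m) y

switch : List (ℕ → ℕ) → (ℕ → ℕ) → ℕ → ℕ → ℕ
switch []       d t       y = d y
switch (f ∷ fs) d zero    y = f y
switch (f ∷ fs) d (suc t) y = switch fs d t y

module _ {O : Real} where

  comp-ext : ∀ {f g} → (∀ n → f n ≡ g n) → Computable O f → Computable O g
  comp-ext f≡g (computable e r) = computable e λ n → subst (O ⊢ e ⇓ n ↦_) (f≡g n) (r n)

  comp-id : Computable O (λ n → n)
  comp-id = computable idc λ n → 1 , refl

  comp-∘ : ∀ {f g} → Computable O f → Computable O g → Computable O (λ n → f (g n))
  comp-∘ (computable e r) (computable e′ r′) = computable (comp e e′) λ n → ↦-comp (r′ n) (r _)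

  comp-suc : ∀ {f} → Computable O f → Computable O (λ n → suc (f n))
  comp-suc = comp-∘ (computable scc λ n → 1 , refl)

  comp-const : ∀ k → Computable O (λ _ → k)
  comp-const zero    = computable zer λ n → 1 , refl
  comp-const (suc k) = comp-suc (comp-const k)

  opaque
    unfolding π₁

    comp-π₁ : ∀ {f} → Computable O f → Computable O (λ n → π₁ (f n))
    comp-π₁ = comp-∘ (computable fstc λ n → 1 , refl)

    comp-π₂ : ∀ {f} → Computable O f → Computable O (λ n → π₂ (f n))
    comp-π₂ = comp-∘ (computable sndc λ n → 1 , refl)

  comp-⟨,⟩ : ∀ {f g} → Computable O f → Computable O g → Computable O (λ n → ⟨ f n , g n ⟩)
  comp-⟨,⟩ (computable e r) (computable e′ r′) =
    computable (pairc e e′) λ n → ↦-pair (r n) (r′ n)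

  comp-app₂ : ∀ h {f g} → Computable₂ O h → Computable O f → Computable O g →
              Computable O (λ n → h (f n) (g n))
  comp-app₂ h {f} {g} ch cf cg =
    comp-ext (λ n → cong₂ h (π₁-⟨,⟩ (f n) (g n)) (π₂-⟨,⟩ (f n) (g n))) (comp-∘ ch (comp-⟨,⟩ cf cg))

  comp-app₃ : ∀ h {f g k} → Computable₃ O h → Computable O f → Computable O g → Computable O k →
              Computable O (λ n → h (f n) (g n) (k n))
  comp-app₃ h {f} {g} {k} ch cf cg ck =
    comp-ext (λ n → cong₂ (h (f n)) (π₁-⟨,⟩ (g n) (k n)) (π₂-⟨,⟩ (g n) (k n)))
             (comp-app₂ (λ a n → h a (π₁ n) (π₂ n)) ch cf (comp-⟨,⟩ cg ck))

  arg₁ : Computable O π₁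
  arg₁ = comp-π₁ comp-id

  arg₂ : Computable O π₂
  arg₂ = comp-π₂ comp-id

  arg₂₁ : Computable O (λ n → π₁ (π₂ n))
  arg₂₁ = comp-π₁ arg₂

  arg₂₂ : Computable O (λ n → π₂ (π₂ n))
  arg₂₂ = comp-π₂ arg₂

  comp-rec : ∀ {b s} → Computable O b → Computable₃ O s → Computable₂ O (rec b s)
  comp-rec {b} {s} (computable e r) (computable e′ r′) =
    computable (prec e e′) λ n → go (π₁ n) (unpair≡π n)
    where
    go : ∀ m {x y} → unpair x ≡ (m , y) → O ⊢ prec e e′ ⇓ x ↦ rec b s m y
    go zero    x≡ = ↦-prec-zero x≡ (r _)
    go (suc m) {y = y} x≡ =
      ↦-prec-suc x≡ (go m (trans (cong unpair (⟨,⟩≡pair m y)) (unpair-pair m y)))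
        (subst (O ⊢ e′ ⇓ z ↦_)
          (trans (cong₂ (s (π₁ z)) (trans (cong π₁ (π₂-⟨,⟩ m w)) (π₁-⟨,⟩ h y))
                                   (trans (cong π₂ (π₂-⟨,⟩ m w)) (π₂-⟨,⟩ h y)))
                 (cong (λ i → s i h y) (π₁-⟨,⟩ m w)))
          (r′ z))
      where
      h = rec b s m y
      w = ⟨ h , y ⟩
      z = ⟨ m , w ⟩

  -- A recursion whose step ignores the previous value. Both branches are evaluated first, which is
  -- harmless since all functions are total.
  comp-ifz : ∀ {f g h} → Computable O f → Computable O g → Computable O h →
             Computable O (λ n → ifz (f n) (g n) (h n))
  comp-ifz {f} {g} {h} cf cg ch =
    comp-ext (λ n → trans (lemma (f n) ⟨ g n , h n ⟩)
                          (cong₂ (ifz (f n)) (π₁-⟨,⟩ (g n) (h n)) (π₂-⟨,⟩ (g n) (h n))))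
             (comp-app₂ (rec π₁ (λ _ _ → π₂)) (comp-rec arg₁ (comp-π₂ arg₂₂)) cf (comp-⟨,⟩ cg ch))
    where
    lemma : ∀ m y → rec π₁ (λ _ _ → π₂) m y ≡ ifz m (π₁ y) (π₂ y)
    lemma zero    y = refl
    lemma (suc m) y = refl

  comp-pred : ∀ {f} → Computable O f → Computable O (λ n → pred (f n))
  comp-pred {f} cf =
    comp-ext (λ n → lemma (f n))
      (comp-app₂ (rec (λ _ → 0) (λ m _ _ → m)) (comp-rec (comp-const 0) arg₁) cf (comp-const 0))
    where
    lemma : ∀ m → rec (λ _ → 0) (λ m _ _ → m) m 0 ≡ pred m
    lemma zero    = refl
    lemma (suc m) = refl

  comp-+ : ∀ {f g} → Computable O f → Computable O g → Computable O (λ n → f n + g n)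
  comp-+ {f} {g} cf cg =
    comp-ext (λ n → lemma (f n) (g n))
      (comp-app₂ (rec (λ y → y) (λ _ h _ → suc h)) (comp-rec comp-id (comp-suc arg₂₁)) cf cg)
    where
    lemma : ∀ m y → rec (λ y → y) (λ _ h _ → suc h) m y ≡ m + y
    lemma zero    y = refl
    lemma (suc m) y = cong suc (lemma m y)

  comp-* : ∀ {f g} → Computable O f → Computable O g → Computable O (λ n → f n * g n)
  comp-* {f} {g} cf cg =
    comp-ext (λ n → lemma (f n) (g n))
      (comp-app₂ (rec (λ _ → 0) (λ _ h y → y + h)) (comp-rec (comp-const 0) (comp-+ arg₂₂ arg₂₁)) cf cg)
    where
    lemma : ∀ m y → rec (λ _ → 0) (λ _ h y → y + h) m y ≡ m * y
    lemma zero    y = refl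
    lemma (suc m) y = cong (y +_) (lemma m y)

  comp-∸ : ∀ {f g} → Computable O f → Computable O g → Computable O (λ n → f n ∸ g n)
  comp-∸ {f} {g} cf cg =
    comp-ext (λ n → lemma (g n) (f n))
      (comp-app₂ (rec (λ y → y) (λ _ h _ → pred h)) (comp-rec comp-id (comp-pred arg₂₁)) cg cf)
    where
    lemma : ∀ m y → rec (λ y → y) (λ _ h _ → pred h) m y ≡ y ∸ m
    lemma zero    y = refl
    lemma (suc m) y = trans (cong pred (lemma m y)) (pred[m∸n]≡m∸[1+n] y m)

  comp-dist : ∀ {f g} → Computable O f → Computable O g → Computable O (λ n → dist (f n) (g n))
  comp-dist cf cg = comp-+ (comp-∸ cf cg) (comp-∸ cg cf)

  comp-not : ∀ {f} → Computable O f → Computable O (λ n → not (f n))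
  comp-not cf = comp-ifz cf (comp-const 1) (comp-const 0)

  comp-exists≤ : ∀ {p} → Computable₂ O p → Computable₂ O (exists≤ p)
  comp-exists≤ {p} cp =
    comp-ext (λ n → lemma (π₁ n) (π₂ n))
      (comp-rec {λ y → p 0 y} {λ m h y → h * p (suc m) y}
        (comp-app₂ p cp (comp-const 0) comp-id)
        (comp-* arg₂₁ (comp-app₂ p cp (comp-suc arg₁) arg₂₂)))
    where
    lemma : ∀ m y → rec (λ y → p 0 y) (λ m h y → h * p (suc m) y) m y ≡ exists≤ p m y
    lemma zero    y = refl
    lemma (suc m) y = cong (_* p (suc m) y) (lemma m y)

  comp-switch : ∀ {fs d} → All (Computable O) fs → Computable O d → Computable₂ O (switch fs d)
  comp-switch [] cd = comp-∘ cd arg₂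
  comp-switch {f ∷ fs} {d} (cf ∷ cfs) cd =
    comp-ext (λ n → lemma (π₁ n) (π₂ n))
      (comp-ifz arg₁ (comp-∘ cf arg₂)
        (comp-app₂ (switch fs d) (comp-switch cfs cd) (comp-pred arg₁) arg₂))
    where
    lemma : ∀ t y → ifz t (f y) (switch fs d (pred t) y) ≡ switch (f ∷ fs) d t y
    lemma zero    y = refl
    lemma (suc t) y = refl

  least-zero : ∀ (p : ℕ → ℕ) n → p n ≡ 0 → ∃[ m ] (p m ≡ 0 × (∀ i → i < m → ∃[ w ] p i ≡ suc w))
  least-zero p zero p0 = 0 , p0 , λ _ ()
  least-zero p (suc n) pn with p 0 in p0
  ... | zero  = 0 , p0 , λ _ ()
  ... | suc w with m , pm , below ← least-zero (λ i → p (suc i)) n pn =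
    suc m , pm , λ { zero _ → w , p0 ; (suc i) (s≤s i<m) → below i i<m }

  -- Every unbounded search made by `X` below goes through this; totality comes from a proof that
  -- may use excluded middle, while the code only searches.
  comp-min : ∀ {p} → Computable₂ O p → (∀ x → ∃[ w ] p w x ≡ 0) →
             ∃[ h ] (Computable O h × (∀ x → p (h x) x ≡ 0))
  comp-min {p} (computable e r) total =
    (λ x → proj₁ (least x)) ,
    computable (mu e) (λ x →
      let m , pm , below = least x in
      ↦-mu m (λ i i<m → proj₁ (below i i<m) , value i (proj₂ (below i i<m))) (value m pm)) ,
    λ x → proj₁ (proj₂ (least x))
    where
    least : ∀ x → ∃[ m ] (p m x ≡ 0 × (∀ i → i < m → ∃[ w ] p i x ≡ suc w))
    least x = least-zero (λ w → p w x) (proj₁ (total x)) (proj₂ (total x))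

    value : ∀ i {x y} → p i x ≡ y → O ⊢ e ⇓ ⟨ i , x ⟩ ↦ y
    value i {x} eq = subst (O ⊢ e ⇓ ⟨ i , x ⟩ ↦_)
      (trans (cong₂ p (π₁-⟨,⟩ i x) (π₂-⟨,⟩ i x)) eq) (r ⟨ i , x ⟩)

dist≡0⇒≡ : ∀ m n → dist m n ≡ 0 → m ≡ n
dist≡0⇒≡ m n eq =
  ≤-antisym (m∸n≡0⇒m≤n (m+n≡0⇒m≡0 (m ∸ n) eq)) (m∸n≡0⇒m≤n (m+n≡0⇒n≡0 (m ∸ n) eq))

≡⇒dist≡0 : ∀ {m n} → m ≡ n → dist m n ≡ 0
≡⇒dist≡0 {n} refl = cong₂ _+_ (n∸n≡0 n) (n∸n≡0 n)

dist-self : ∀ n → dist n n ≡ 0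
dist-self n = ≡⇒dist≡0 {n} refl

not≡0⇒≢0 : ∀ n → not n ≡ 0 → n ≢ 0
not≡0⇒≢0 (suc n) _ ()

≢0⇒not≡0 : ∀ n → n ≢ 0 → not n ≡ 0
≢0⇒not≡0 zero    n≢0 = contradiction refl n≢0
≢0⇒not≡0 (suc n) _   = refl

exists≤-intro : ∀ {p y} i {m} → i ≤ m → p i y ≡ 0 → exists≤ p m y ≡ 0
exists≤-intro {p} {y} i {zero} z≤n pi = pi
exists≤-intro {p} {y} i {suc m} i≤1+m pi with m≤n⇒m<n∨m≡n i≤1+m
... | inj₁ (s≤s i≤m) rewrite exists≤-intro {p} {y} i i≤m pi = refl
... | inj₂ refl rewrite pi = *-zeroʳ (exists≤ p m y)

exists≤-elim : ∀ {p y} m → exists≤ p m y ≡ 0 → ∃[ i ] (i ≤ m × p i y ≡ 0)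
exists≤-elim zero eq = 0 , z≤n , eq
exists≤-elim {p} {y} (suc m) eq with m*n≡0⇒m≡0∨n≡0 (exists≤ p m y) eq
... | inj₁ eq′ with i , i≤m , pi ← exists≤-elim m eq′ = i , m≤n⇒m≤1+n i≤m , pi
... | inj₂ p≡0 = suc m , ≤-refl , p≡0

-- Universality: halting as a decidable relation of program, input and stage

-- A universal stack machine for the empty oracle. A state ⟨ v , S ⟩ holds a value and a
-- stack of items ⟨ tag , payload ⟩; tags 0-9 are codes to be run on the value, tags 10-13 are
-- the continuations of pairc, prec and mu, and any larger tag loops.

-- The successor reserves 0 for the empty stack.
push : ℕ → ℕ → ℕ
push i K = suc ⟨ i , K ⟩

⌜_⌝ : Code → ℕ
⌜ zer ⌝       = ⟨ 0 , 0 ⟩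
⌜ scc ⌝       = ⟨ 1 , 0 ⟩
⌜ idc ⌝       = ⟨ 2 , 0 ⟩
⌜ orc ⌝       = ⟨ 3 , 0 ⟩
⌜ fstc ⌝      = ⟨ 4 , 0 ⟩
⌜ sndc ⌝      = ⟨ 5 , 0 ⟩
⌜ pairc f g ⌝ = ⟨ 6 , ⟨ ⌜ f ⌝ , ⌜ g ⌝ ⟩ ⟩
⌜ comp f g ⌝  = ⟨ 7 , ⟨ ⌜ f ⌝ , ⌜ g ⌝ ⟩ ⟩
⌜ prec f g ⌝  = ⟨ 8 , ⟨ ⌜ f ⌝ , ⌜ g ⌝ ⟩ ⟩
⌜ mu f ⌝      = ⟨ 9 , ⌜ f ⌝ ⟩

-- Here `y` is ⟨ candidate , input ⟩. Continuation 13 remembers both the code and `y`, so the next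
-- round can be started from it.
mu-loop : ℕ → ℕ → ℕ → ℕ
mu-loop f y K = ⟨ y , push f (push ⟨ 13 , ⟨ f , y ⟩ ⟩ K) ⟩

do-zer do-scc do-idc do-fst do-snd do-pair do-comp do-prec do-mu
  do-snd-of-pair do-make-pair do-prec-next do-mu-next : ℕ → ℕ → ℕ → ℕ
do-zer p v K = ⟨ 0 , K ⟩
do-scc p v K = ⟨ suc v , K ⟩
do-idc p v K = ⟨ v , K ⟩
do-fst p v K = ⟨ π₁ v , K ⟩
do-snd p v K = ⟨ π₂ v , K ⟩
do-pair p v K = ⟨ v , push (π₁ p) (push ⟨ 10 , ⟨ π₂ p , v ⟩ ⟩ K) ⟩
do-comp p v K = ⟨ v , push (π₂ p) (push (π₁ p) K) ⟩
do-prec p v K = ifz (π₁ v)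
  ⟨ π₂ v , push (π₁ p) K ⟩
  ⟨ ⟨ pred (π₁ v) , π₂ v ⟩ , push ⟨ 8 , p ⟩ (push ⟨ 12 , ⟨ pred (π₁ v) , π₂ v ⟩ ⟩ (push (π₂ p) K)) ⟩
do-mu p v K = mu-loop p ⟨ 0 , v ⟩ K
do-snd-of-pair p v K = ⟨ π₂ p , push (π₁ p) (push ⟨ 11 , v ⟩ K) ⟩
do-make-pair p v K = ⟨ ⟨ p , v ⟩ , K ⟩
do-prec-next p v K = ⟨ ⟨ π₁ p , ⟨ v , π₂ p ⟩ ⟩ , K ⟩
do-mu-next p v K = ifz v
  ⟨ π₁ (π₂ p) , K ⟩
  (mu-loop (π₁ p) ⟨ suc (π₁ (π₂ p)) , π₂ (π₂ p) ⟩ K)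

on-triple : (ℕ → ℕ → ℕ → ℕ) → ℕ → ℕ
on-triple f y = f (π₁ y) (π₁ (π₂ y)) (π₂ (π₂ y))

on-triple-≡ : ∀ f a b c → on-triple f ⟨ a , ⟨ b , c ⟩ ⟩ ≡ f a b c
on-triple-≡ f a b c
  rewrite π₁-⟨,⟩ a ⟨ b , c ⟩ | π₂-⟨,⟩ a ⟨ b , c ⟩ | π₁-⟨,⟩ b c | π₂-⟨,⟩ b c = refl

do-loop : ℕ → ℕ → ℕ → ℕ
do-loop p v K = ⟨ v , push ⟨ 14 , 0 ⟩ K ⟩

dispatch : ℕ → ℕ → ℕ
dispatch = switch
  -- Tag 3, the oracle query, acts as `zer` because the oracle is empty.
  ( on-triple do-zer ∷ on-triple do-scc ∷ on-triple do-idc ∷ on-triple do-zer ∷ on-triple do-fst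
  ∷ on-triple do-snd ∷ on-triple do-pair ∷ on-triple do-comp ∷ on-triple do-prec ∷ on-triple do-mu
  ∷ on-triple do-snd-of-pair ∷ on-triple do-make-pair ∷ on-triple do-prec-next
  ∷ on-triple do-mu-next ∷ [])
  (on-triple do-loop)

item : ℕ → ℕ
item S = π₁ (pred S)

-- States with empty stack are fixed, so halting persists at later stages.
step : ℕ → ℕ
step z = ifz (π₂ z) z
  (dispatch (π₁ (item (π₂ z))) ⟨ π₂ (item (π₂ z)) , ⟨ π₁ z , π₂ (pred (π₂ z)) ⟩ ⟩)

run : ℕ → ℕ → ℕ
run = rec (λ z → z) (λ _ z _ → step z)

module _ {O : Real} where

  comp-push : ∀ {f g} → Computable O f → Computable O g → Computable O (λ n → push (f n) (g n))
  comp-push cf cg = comp-suc (comp-⟨,⟩ cf cg)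

  comp-mu-loop : ∀ {f g h} → Computable O f → Computable O g → Computable O h →
                 Computable O (λ n → mu-loop (f n) (g n) (h n))
  comp-mu-loop cf cg ch =
    comp-⟨,⟩ cg (comp-push cf (comp-push (comp-⟨,⟩ (comp-const 13) (comp-⟨,⟩ cf cg)) ch))

  comp-dispatch : Computable₂ O dispatch
  comp-dispatch = comp-switch
    ( comp-⟨,⟩ (comp-const 0) K ∷ comp-⟨,⟩ (comp-suc v) K ∷ comp-⟨,⟩ v K
    ∷ comp-⟨,⟩ (comp-const 0) K ∷ comp-⟨,⟩ (comp-π₁ v) K ∷ comp-⟨,⟩ (comp-π₂ v) K
    ∷ comp-⟨,⟩ v (comp-push p₁ (comp-push (comp-⟨,⟩ (comp-const 10) (comp-⟨,⟩ p₂ v)) K))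
    ∷ comp-⟨,⟩ v (comp-push p₂ (comp-push p₁ K))
    ∷ comp-ifz (comp-π₁ v) (comp-⟨,⟩ (comp-π₂ v) (comp-push p₁ K))
        (comp-⟨,⟩ v↓ (comp-push (comp-⟨,⟩ (comp-const 8) p)
                        (comp-push (comp-⟨,⟩ (comp-const 12) v↓) (comp-push p₂ K))))
    ∷ comp-mu-loop p (comp-⟨,⟩ (comp-const 0) v) K
    ∷ comp-⟨,⟩ p₂ (comp-push p₁ (comp-push (comp-⟨,⟩ (comp-const 11) v) K))
    ∷ comp-⟨,⟩ (comp-⟨,⟩ p v) K
    ∷ comp-⟨,⟩ (comp-⟨,⟩ p₁ (comp-⟨,⟩ v p₂)) K
    ∷ comp-ifz v (comp-⟨,⟩ (comp-π₁ p₂) K)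
        (comp-mu-loop p₁ (comp-⟨,⟩ (comp-suc (comp-π₁ p₂)) (comp-π₂ p₂)) K)
    ∷ [])
    (comp-⟨,⟩ v (comp-push (comp-⟨,⟩ (comp-const 14) (comp-const 0)) K))
    where
    p  = arg₁
    v  = arg₂₁
    K  = arg₂₂
    p₁ = comp-π₁ p
    p₂ = comp-π₂ p
    v↓ = comp-⟨,⟩ (comp-pred (comp-π₁ v)) (comp-π₂ v)

  comp-run : Computable₂ O run
  comp-run = comp-rec comp-id (comp-ifz (comp-π₂ z) z
    (comp-app₂ dispatch comp-dispatch (comp-π₁ i)
      (comp-⟨,⟩ (comp-π₂ i) (comp-⟨,⟩ (comp-π₁ z) (comp-π₂ (comp-pred (comp-π₂ z)))))))
    where
    z = arg₂₁
    i = comp-π₁ (comp-pred (comp-π₂ z))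

-- Transitions of the machine and agreement with `eval`

step-push : ∀ t p v K → step ⟨ v , push ⟨ t , p ⟩ K ⟩ ≡ dispatch t ⟨ p , ⟨ v , K ⟩ ⟩
step-push t p v K
  rewrite π₂-⟨,⟩ v (push ⟨ t , p ⟩ K) | π₁-⟨,⟩ v (push ⟨ t , p ⟩ K)
        | π₁-⟨,⟩ ⟨ t , p ⟩ K | π₂-⟨,⟩ ⟨ t , p ⟩ K | π₁-⟨,⟩ t p | π₂-⟨,⟩ t p = refl

run-+ : ∀ m n z → run (m + n) z ≡ run m (run n z)
run-+ zero    n z = refl
run-+ (suc m) n z = cong step (run-+ m n z)

run-suc : ∀ n z → run (suc n) z ≡ run n (step z)
run-suc n z = trans (cong (λ k → run k z) (+-comm 1 n)) (run-+ n 1 z)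

_⟶*_ : ℕ → ℕ → Set
z ⟶* z′ = ∃[ n ] run n z ≡ z′

⟶*-trans : ∀ {x y z} → x ⟶* y → y ⟶* z → x ⟶* z
⟶*-trans {x} (m , refl) (n , refl) = n + m , run-+ n m x

infixr 4 _then_
_then_ : ∀ {x y z} → step x ≡ y → y ⟶* z → x ⟶* z
eq then y⟶*z = ⟶*-trans (1 , eq) y⟶*z

infixr 4 _⨾_
_⨾_ : ∀ {x y z} → x ⟶* y → y ⟶* z → x ⟶* z
_⨾_ = ⟶*-trans

done : ∀ {x} → x ⟶* x
done = 0 , refl

module _ {v K : ℕ} where

  step-simple : ∀ t {p w} → dispatch t ⟨ p , ⟨ v , K ⟩ ⟩ ≡ w → step ⟨ v , push ⟨ t , p ⟩ K ⟩ ≡ w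
  step-simple t {p} = trans (step-push t p v K)

  step-zer : step ⟨ v , push ⌜ zer ⌝ K ⟩ ≡ ⟨ 0 , K ⟩
  step-zer = step-simple 0 (on-triple-≡ do-zer _ _ _)

  step-scc : step ⟨ v , push ⌜ scc ⌝ K ⟩ ≡ ⟨ suc v , K ⟩
  step-scc = step-simple 1 (on-triple-≡ do-scc _ _ _)

  step-idc : step ⟨ v , push ⌜ idc ⌝ K ⟩ ≡ ⟨ v , K ⟩
  step-idc = step-simple 2 (on-triple-≡ do-idc _ _ _)

  step-orc : step ⟨ v , push ⌜ orc ⌝ K ⟩ ≡ ⟨ 0 , K ⟩
  step-orc = step-simple 3 (on-triple-≡ do-zer _ _ _)

  step-fst : step ⟨ v , push ⌜ fstc ⌝ K ⟩ ≡ ⟨ π₁ v , K ⟩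
  step-fst = step-simple 4 (on-triple-≡ do-fst _ _ _)

  step-snd : step ⟨ v , push ⌜ sndc ⌝ K ⟩ ≡ ⟨ π₂ v , K ⟩
  step-snd = step-simple 5 (on-triple-≡ do-snd _ _ _)

  step-pair : ∀ f g → step ⟨ v , push ⌜ pairc f g ⌝ K ⟩ ≡
              ⟨ v , push ⌜ f ⌝ (push ⟨ 10 , ⟨ ⌜ g ⌝ , v ⟩ ⟩ K) ⟩
  step-pair f g = step-simple 6 (trans (on-triple-≡ do-pair _ _ _)
    (cong₂ (λ a b → ⟨ v , push a (push ⟨ 10 , ⟨ b , v ⟩ ⟩ K) ⟩) (π₁-⟨,⟩ _ _) (π₂-⟨,⟩ _ _)))

  step-comp : ∀ f g → step ⟨ v , push ⌜ comp f g ⌝ K ⟩ ≡ ⟨ v , push ⌜ g ⌝ (push ⌜ f ⌝ K) ⟩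
  step-comp f g = step-simple 7 (trans (on-triple-≡ do-comp _ _ _)
    (cong₂ (λ a b → ⟨ v , push b (push a K) ⟩) (π₁-⟨,⟩ _ _) (π₂-⟨,⟩ _ _)))

  step-prec-zero : ∀ f g {y} → unpair v ≡ (0 , y) →
                   step ⟨ v , push ⌜ prec f g ⌝ K ⟩ ≡ ⟨ y , push ⌜ f ⌝ K ⟩
  step-prec-zero f g v≡ = step-simple 8 (trans (on-triple-≡ do-prec _ _ _) eq)
    where
    eq : do-prec ⟨ ⌜ f ⌝ , ⌜ g ⌝ ⟩ v K ≡ ⟨ _ , push ⌜ f ⌝ K ⟩
    eq rewrite cong proj₁ (trans (sym (unpair≡π v)) v≡) | cong proj₂ (trans (sym (unpair≡π v)) v≡)
             | π₁-⟨,⟩ ⌜ f ⌝ ⌜ g ⌝ = refl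

  step-prec-suc : ∀ f g {n y} → unpair v ≡ (suc n , y) →
                  step ⟨ v , push ⌜ prec f g ⌝ K ⟩ ≡
                  ⟨ ⟨ n , y ⟩ , push ⌜ prec f g ⌝ (push ⟨ 12 , ⟨ n , y ⟩ ⟩ (push ⌜ g ⌝ K)) ⟩
  step-prec-suc f g {n} {y} v≡ = step-simple 8 (trans (on-triple-≡ do-prec _ _ _) eq)
    where
    p = ⟨ ⌜ f ⌝ , ⌜ g ⌝ ⟩
    eq : do-prec p v K ≡ ⟨ ⟨ n , y ⟩ , push ⟨ 8 , p ⟩ (push ⟨ 12 , ⟨ n , y ⟩ ⟩ (push ⌜ g ⌝ K)) ⟩
    eq rewrite cong proj₁ (trans (sym (unpair≡π v)) v≡) | cong proj₂ (trans (sym (unpair≡π v)) v≡)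
             | π₂-⟨,⟩ ⌜ f ⌝ ⌜ g ⌝ = refl

  step-mu : ∀ f → step ⟨ v , push ⌜ mu f ⌝ K ⟩ ≡ mu-loop ⌜ f ⌝ ⟨ 0 , v ⟩ K
  step-mu f = step-simple 9 (on-triple-≡ do-mu _ _ _)

  step-snd-of-pair : ∀ g x → step ⟨ v , push ⟨ 10 , ⟨ g , x ⟩ ⟩ K ⟩ ≡
                     ⟨ x , push g (push ⟨ 11 , v ⟩ K) ⟩
  step-snd-of-pair g x = step-simple 10 (trans (on-triple-≡ do-snd-of-pair _ _ _)
    (cong₂ (λ a b → ⟨ b , push a (push ⟨ 11 , v ⟩ K) ⟩) (π₁-⟨,⟩ _ _) (π₂-⟨,⟩ _ _)))

  step-make-pair : ∀ a → step ⟨ v , push ⟨ 11 , a ⟩ K ⟩ ≡ ⟨ ⟨ a , v ⟩ , K ⟩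
  step-make-pair a = step-simple 11 (on-triple-≡ do-make-pair _ _ _)

  step-prec-next : ∀ n y → step ⟨ v , push ⟨ 12 , ⟨ n , y ⟩ ⟩ K ⟩ ≡ ⟨ ⟨ n , ⟨ v , y ⟩ ⟩ , K ⟩
  step-prec-next n y = step-simple 12 (trans (on-triple-≡ do-prec-next _ _ _)
    (cong₂ (λ a b → ⟨ ⟨ a , ⟨ v , b ⟩ ⟩ , K ⟩) (π₁-⟨,⟩ _ _) (π₂-⟨,⟩ _ _)))

  step-loop : step ⟨ v , push ⟨ 14 , 0 ⟩ K ⟩ ≡ ⟨ v , push ⟨ 14 , 0 ⟩ K ⟩
  step-loop = step-simple 14 (on-triple-≡ do-loop _ _ _)

step-mu-next : ∀ {K} v f n x →
  step ⟨ v , push ⟨ 13 , ⟨ f , ⟨ n , x ⟩ ⟩ ⟩ K ⟩ ≡ ifz v ⟨ n , K ⟩ (mu-loop f ⟨ suc n , x ⟩ K)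
step-mu-next {K} v f n x = step-simple 13 (trans (on-triple-≡ do-mu-next _ _ _) eq)
  where
  eq : do-mu-next ⟨ f , ⟨ n , x ⟩ ⟩ v K ≡ ifz v ⟨ n , K ⟩ (mu-loop f ⟨ suc n , x ⟩ K)
  eq rewrite π₁-⟨,⟩ f ⟨ n , x ⟩ | π₂-⟨,⟩ f ⟨ n , x ⟩ | π₁-⟨,⟩ n x | π₂-⟨,⟩ n x = refl

-- Induction on the fuel, with an arbitrary stack `K` underneath so that the runs of subcodes can be
-- chained.
runs-code : ∀ k c {x y} → eval k c ∅ x ≡ just y → ∀ K → ⟨ x , push ⌜ c ⌝ K ⟩ ⟶* ⟨ y , K ⟩
runs-mu : ∀ k f {x y} b n → search b (λ i → eval k f ∅ (pair i x)) n ≡ just y →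
          ∀ K → mu-loop ⌜ f ⌝ ⟨ n , x ⟩ K ⟶* ⟨ y , K ⟩

runs-code (suc k) zer refl K = 1 , step-zer
runs-code (suc k) scc refl K = 1 , step-scc
runs-code (suc k) idc refl K = 1 , step-idc
runs-code (suc k) orc refl K = 1 , step-orc
runs-code (suc k) fstc {x} refl K =
  1 , trans step-fst (cong ⟨_, K ⟩ (sym (cong proj₁ (unpair≡π x))))
runs-code (suc k) sndc {x} refl K =
  1 , trans step-snd (cong ⟨_, K ⟩ (sym (cong proj₂ (unpair≡π x))))
runs-code (suc k) (pairc f g) {x} eq K
  with a , fa , eq′ ← >>=-just (eval k f ∅ x) eq
  with b , gb , refl ← >>=-just (eval k g ∅ x) eq′ =
  step-pair f g then runs-code k f fa _ ⨾ step-snd-of-pair ⌜ g ⌝ x then runs-code k g gb _ ⨾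
  (1 , trans (step-make-pair a) (cong ⟨_, K ⟩ (⟨,⟩≡pair a b)))
runs-code (suc k) (comp f g) {x} eq K
  with a , ga , fa ← >>=-just (eval k g ∅ x) eq =
  step-comp f g then runs-code k g ga _ ⨾ runs-code k f fa K
runs-code (suc k) (prec f g) {x} eq K with unpair x in x≡
... | zero , y = step-prec-zero f g x≡ then runs-code k f eq K
... | suc n , y
  with h , ph , gh ← >>=-just (eval k (prec f g) ∅ (pair n y)) eq
  rewrite sym (⟨,⟩≡pair n y) | sym (⟨,⟩≡pair h y) | sym (⟨,⟩≡pair n ⟨ h , y ⟩) =
  step-prec-suc f g x≡ then runs-code k (prec f g) ph _ ⨾ step-prec-next n y then runs-code k g gh K
runs-code (suc k) (mu f) eq K = step-mu f then runs-mu k f k 0 eq K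

runs-mu k f {x} (suc b) n eq K with eval k f ∅ (pair n x) in fn
... | just zero with refl ← eq =
  runs-code k f (subst (λ z → eval k f ∅ z ≡ just 0) (sym (⟨,⟩≡pair n x)) fn) _ ⨾
  step-mu-next 0 ⌜ f ⌝ n x then done
... | just (suc w) =
  runs-code k f (subst (λ z → eval k f ∅ z ≡ just (suc w)) (sym (⟨,⟩≡pair n x)) fn) _ ⨾
  step-mu-next (suc w) ⌜ f ⌝ n x then runs-mu k f b (suc n) eq K

record Halts (n z : ℕ) : Set where
  constructor halted
  field
    stack-empty : π₂ (run n z) ≡ 0
open Halts

step-halted : ∀ z → π₂ z ≡ 0 → π₂ (step z) ≡ 0
step-halted z eq = trans (cong π₂ (lemma (π₂ z) eq)) eq
  where
  lemma : ∀ S {a b} → S ≡ 0 → ifz S a b ≡ a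
  lemma zero _ = refl

halts-mono : ∀ {m n z} → m ≤ n → Halts m z → Halts n z
halts-mono {m} {n} {z} m≤n = go (≤⇒≤′ m≤n)
  where
  go : ∀ {n} → m ≤′ n → Halts m z → Halts n z
  go ≤′-refl      h = h
  go (≤′-step {k} le) h = halted (step-halted (run k z) (stack-empty (go le h)))

halts-step : ∀ {n v i K z} → Halts n ⟨ v , push i K ⟩ → step ⟨ v , push i K ⟩ ≡ z →
             ∃[ m ] (n ≡ suc m × Halts m z)
halts-step {zero} {v} {i} {K} (halted h) eq with () ← trans (sym (π₂-⟨,⟩ v (push i K))) h
halts-step {suc n} {v} {i} {K} (halted h) refl =
  n , refl , halted (subst (λ z → π₂ z ≡ 0) (run-suc n _) h)

extend-below : ∀ {f x i w} → (∀ j → j < i → ∃[ w ] ∅ ⊢ f ⇓ ⟨ j , x ⟩ ↦ suc w) →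
               ∅ ⊢ f ⇓ ⟨ i , x ⟩ ↦ suc w → ∀ j → j < suc i → ∃[ w ] ∅ ⊢ f ⇓ ⟨ j , x ⟩ ↦ suc w
extend-below below fi j j<1+i with m≤n⇒m<n∨m≡n (≤-pred j<1+i)
... | inj₁ j<i  = below j j<i
... | inj₂ refl = _ , fi

-- Recursion on a bound `b` for the number of steps, since the code need not shrink: `prec` calls
-- itself and `mu` repeats its body. The conclusion `m < n` makes each subrun pay for what follows
-- it.
halts-code : ∀ b {n} → n ≤ b → ∀ c {x K} → Halts n ⟨ x , push ⌜ c ⌝ K ⟩ →
             ∃[ m ] ∃[ y ] (m < n × ∅ ⊢ c ⇓ x ↦ y × Halts m ⟨ y , K ⟩)
halts-mu : ∀ b {n} → n ≤ b → ∀ f i {x K} → (∀ j → j < i → ∃[ w ] ∅ ⊢ f ⇓ ⟨ j , x ⟩ ↦ suc w) →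
           Halts n (mu-loop ⌜ f ⌝ ⟨ i , x ⟩ K) →
           ∃[ m ] ∃[ y ] (m < n × ∅ ⊢ mu f ⇓ x ↦ y × Halts m ⟨ y , K ⟩)

halts-code b n≤b zer h with m , refl , h₁ ← halts-step h step-zer =
  m , 0 , ≤-refl , (1 , refl) , h₁
halts-code b n≤b scc {x} h with m , refl , h₁ ← halts-step h step-scc =
  m , suc x , ≤-refl , (1 , refl) , h₁
halts-code b n≤b idc {x} h with m , refl , h₁ ← halts-step h step-idc =
  m , x , ≤-refl , (1 , refl) , h₁
halts-code b n≤b orc h with m , refl , h₁ ← halts-step h step-orc =
  m , 0 , ≤-refl , (1 , refl) , h₁
halts-code b n≤b fstc {x} h with m , refl , h₁ ← halts-step h step-fst =
  m , π₁ x , ≤-refl , (1 , cong just (cong proj₁ (unpair≡π x))) , h₁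
halts-code b n≤b sndc {x} h with m , refl , h₁ ← halts-step h step-snd =
  m , π₂ x , ≤-refl , (1 , cong just (cong proj₂ (unpair≡π x))) , h₁
halts-code (suc b) n≤b (pairc f g) {x} h
  with n₁ , refl , h₁ ← halts-step h (step-pair f g)
  with n₂ , u , lt₂ , fu , h₂ ← halts-code b (≤-pred n≤b) f h₁
  with n₃ , refl , h₃ ← halts-step h₂ (step-snd-of-pair ⌜ g ⌝ x)
  with n₄ , v , lt₄ , gv , h₄ ← halts-code b (≤-trans (<⇒≤ (<⇒≤ lt₂)) (≤-pred n≤b)) g h₃
  with n₅ , refl , h₅ ← halts-step h₄ (step-make-pair u) =
  n₅ , ⟨ u , v ⟩ , <-trans (n<1+n n₅) (<-trans lt₄ (<-trans (n<1+n n₃) (<-trans lt₂ (n<1+n n₁)))) ,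
  ↦-pair fu gv , h₅
halts-code (suc b) n≤b (comp f g) h
  with n₁ , refl , h₁ ← halts-step h (step-comp f g)
  with n₂ , u , lt₂ , gu , h₂ ← halts-code b (≤-pred n≤b) g h₁
  with n₃ , v , lt₃ , fv , h₃ ← halts-code b (≤-trans (<⇒≤ lt₂) (≤-pred n≤b)) f h₂ =
  n₃ , v , <-trans lt₃ (<-trans lt₂ (n<1+n n₁)) , ↦-comp gu fv , h₃
halts-code (suc b) n≤b (prec f g) {x} h with unpair x in x≡
... | zero , y
  with n₁ , refl , h₁ ← halts-step h (step-prec-zero f g x≡)
  with n₂ , u , lt₂ , fu , h₂ ← halts-code b (≤-pred n≤b) f h₁ =
  n₂ , u , <-trans lt₂ (n<1+n n₁) , ↦-prec-zero x≡ fu , h₂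
... | suc i , y
  with n₁ , refl , h₁ ← halts-step h (step-prec-suc f g x≡)
  with n₂ , u , lt₂ , pu , h₂ ← halts-code b (≤-pred n≤b) (prec f g) h₁
  with n₃ , refl , h₃ ← halts-step h₂ (step-prec-next i y)
  with n₄ , v , lt₄ , gv , h₄ ← halts-code b (≤-trans (<⇒≤ (<⇒≤ lt₂)) (≤-pred n≤b)) g h₃ =
  n₄ , v , <-trans lt₄ (<-trans (n<1+n n₃) (<-trans lt₂ (n<1+n n₁))) , ↦-prec-suc x≡ pu gv , h₄
halts-code (suc b) n≤b (mu f) h
  with n₁ , refl , h₁ ← halts-step h (step-mu f)
  with n₂ , v , lt₂ , mv , h₂ ← halts-mu b (≤-pred n≤b) f 0 (λ _ ()) h₁ =
  n₂ , v , <-trans lt₂ (n<1+n n₁) , mv , h₂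
-- With no steps left, the item on the stack contradicts halting.
halts-code zero z≤n (pairc f g) h with _ , () , _ ← halts-step h refl
halts-code zero z≤n (comp f g)  h with _ , () , _ ← halts-step h refl
halts-code zero z≤n (prec f g)  h with _ , () , _ ← halts-step h refl
halts-code zero z≤n (mu f)      h with _ , () , _ ← halts-step h refl

halts-mu b n≤b f i {x} below h with halts-code b n≤b f h
halts-mu b n≤b f i {x} below h | _ , zero , lt₁ , fi , h₁
  with n₂ , refl , h₂ ← halts-step h₁ (step-mu-next 0 ⌜ f ⌝ i x) =
  n₂ , i , <-trans (n<1+n n₂) lt₁ , ↦-mu i below fi , h₂
halts-mu zero z≤n f i below h | _ , suc w , () , _
halts-mu (suc b) n≤b f i {x} below h | _ , suc w , lt₁ , fi , h₁
  with n₂ , refl , h₂ ← halts-step h₁ (step-mu-next (suc w) ⌜ f ⌝ i x)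
  with n₃ , y , lt₃ , my , h₃ ←
    halts-mu b (≤-pred (≤-trans (<⇒≤ lt₁) n≤b)) f (suc i) (extend-below below fi) h₂ =
  n₃ , y , <-trans lt₃ (<-trans (n<1+n n₂) lt₁) , my , h₃

-- The remaining stack, which is 0 exactly when the machine has stopped.
halt-value : ℕ → ℕ → ℕ → ℕ
halt-value e x n = π₂ (run n ⟨ x , push e 0 ⟩)

halts⇒⇓ : ∀ c x n → halt-value ⌜ c ⌝ x n ≡ 0 → ∅ ⊢ c ⇓ x
halts⇒⇓ c x n h with _ , y , _ , cy , _ ← halts-code n ≤-refl c (halted h) = y , cy

⇓⇒halts : ∀ c x → ∅ ⊢ c ⇓ x → ∃[ n ] halt-value ⌜ c ⌝ x n ≡ 0
⇓⇒halts c x (y , k , eq) with n , run≡ ← runs-code k c eq 0 = n , trans (cong π₂ run≡) (π₂-⟨,⟩ y 0)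

halt-value-mono : ∀ e x {m n} → m ≤ n → halt-value e x m ≡ 0 → halt-value e x n ≡ 0
halt-value-mono e x m≤n h = stack-empty (halts-mono {z = ⟨ x , push e 0 ⟩} m≤n (halted h))

loop-never-halts : ∀ x n → halt-value ⟨ 14 , 0 ⟩ x n ≢ 0
loop-never-halts x n h = 1+n≢0 (trans (sym (trans (cong π₂ (stays n)) (π₂-⟨,⟩ x _))) h)
  where
  z = ⟨ x , push ⟨ 14 , 0 ⟩ 0 ⟩
  stays : ∀ n → run n z ≡ z
  stays zero    = refl
  stays (suc n) = trans (cong step (stays n)) step-loop

comp-halt-value : ∀ {O} → Computable₃ O halt-value
comp-halt-value = comp-π₂ (comp-app₂ run comp-run arg₂₂
  (comp-⟨,⟩ arg₂₁ (comp-push arg₁ (comp-const 0))))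

-- Maximal families of indices from the FIP hypothesis

is-zero : ℕ → Bool
is-zero zero    = true
is-zero (suc _) = false

bit-is-zero : ∀ n → bit (is-zero n) ≡ not n
bit-is-zero zero    = refl
bit-is-zero (suc n) = refl

≡0⇒is-zero : ∀ {n} → n ≡ 0 → is-zero n ≡ true
≡0⇒is-zero refl = refl

is-zero⇒≡0 : ∀ n → is-zero n ≡ true → n ≡ 0
is-zero⇒≡0 zero _ = refl

bit-injective : ∀ {a b} → bit a ≡ bit b → a ≡ b
bit-injective {true}  {true}  _ = refl
bit-injective {false} {false} _ = refl

run-at-pair : ∀ {O h} (c : Computable₂ O h) i n → O ⊢ code c ⇓ pair i n ↦ h i n
run-at-pair {O} {h} c i n = subst (λ z → O ⊢ code c ⇓ z ↦ h i n) (⟨,⟩≡pair i n)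
  (subst (O ⊢ code c ⇓ ⟨ i , n ⟩ ↦_) (cong₂ h (π₁-⟨,⟩ i n) (π₂-⟨,⟩ i n)) (runs c ⟨ i , n ⟩))

SolvesFIP : Real → Set
SolvesFIP X = ∀ (𝕏 : ℕ → Real) → UniformlyComputable 𝕏 → NotAllEmpty 𝕏 →
              ∃[ f ] (ComputesFun X f × IsFIP 𝕏 f)

InRange : (ℕ → ℕ) → ℕ → Set
InRange f i = ∃[ k ] f k ≡ i

-- Maximality speaks of indices instead of sets, so that membership can be observed by waiting for
-- the index in `enum`; equality of sets could not be tested.
record MaximalEnumeration (X : Real) (p : ℕ → ℕ → ℕ) : Set where
  field
    enum       : ℕ → ℕ
    computes   : Computable X enum
    consistent : ∀ l → All (InRange enum) l → ∃[ t ] All (λ i → p i t ≡ 0) l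
    maximal    : ∀ i → (∀ l → All (InRange enum) l → ∃[ t ] All (λ i → p i t ≡ 0) (i ∷ l)) →
                 InRange enum i

module _ {X : Real} (em : ExcludedMiddle 0ℓ) (solve : SolvesFIP X)
         {p : ℕ → ℕ → ℕ} (comp-p : Computable₂ ∅ p) {i₀ t₀} (p₀ : p i₀ t₀ ≡ 0) where

  -- The i-th set consists of the ⟨ j , t ⟩ with j ≢ i and p i t: the slices j leave all finite
  -- intersections alone, but make distinct nonempty sets of the family different.
  private
    q : ℕ → ℕ → ℕ
    q i n = p i (π₂ n) + not (dist (π₁ n) i)

    𝕏 : ℕ → Real
    𝕏 i n = is-zero (q i n)

    ∈-intro : ∀ {i j t} → p i t ≡ 0 → j ≢ i → 𝕏 i ⟨ j , t ⟩ ≡ true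
    ∈-intro {i} {j} {t} pit j≢i rewrite π₁-⟨,⟩ j t | π₂-⟨,⟩ j t | pit =
      ≡0⇒is-zero (≢0⇒not≡0 (dist j i) (λ eq → j≢i (dist≡0⇒≡ j i eq)))

    ∈-elim : ∀ {i n} → 𝕏 i n ≡ true → p i (π₂ n) ≡ 0 × π₁ n ≢ i
    ∈-elim {i} {n} n∈ =
      m+n≡0⇒m≡0 _ q≡0 ,
      λ { refl → not≡0⇒≢0 (dist i i) (m+n≡0⇒n≡0 (p i (π₂ n)) q≡0) (dist-self i) }
      where q≡0 = is-zero⇒≡0 (q i n) n∈

    uniform : UniformlyComputable 𝕏
    uniform = code c , λ i n →
      subst (∅ ⊢ code c ⇓ pair i n ↦_) (sym (bit-is-zero (q i n))) (run-at-pair c i n)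
      where
      opaque
        c : Computable₂ ∅ (λ i n → not (q i n))
        c = comp-not (comp-+ (comp-app₂ p comp-p arg₁ arg₂₂) (comp-not (comp-dist arg₂₁ arg₁)))

    nonempty : NotAllEmpty 𝕏
    nonempty = i₀ , ⟨ suc i₀ , t₀ ⟩ , ∈-intro p₀ 1+n≢n

    -- The set with index i leaves out only slice i, so a slice beyond all indices of a finite list
    -- is left out by none of them.
    above : ∀ l → ∃[ j ] All (_< j) l
    above []      = 0 , []
    above (i ∷ l) with j , l<j ← above l =
      suc i ⊔ j , m≤m⊔n (suc i) j ∷ All.map (λ k<j → ≤-trans k<j (m≤n⊔m (suc i) j)) l<j

    module _ {f : ℕ → ℕ} (fip : IsFIP 𝕏 f) where

      positions : ∀ {l} → All (InRange f) l → List ℕ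
      positions []            = []
      positions ((k , _) ∷ r) = k ∷ positions r

      at-positions : ∀ {l n} (r : All (InRange f) l) → All (λ k → 𝕏 (f k) n ≡ true) (positions r) →
                     All (λ i → p i (π₂ n) ≡ 0) l
      at-positions []               []       = []
      at-positions ((k , refl) ∷ r) (∈ ∷ ∈s) = proj₁ (∈-elim ∈) ∷ at-positions r ∈s

      f-consistent : ∀ l → All (InRange f) l → ∃[ t ] All (λ i → p i t ≡ 0) l
      f-consistent l r with n , ∈s ← proj₁ fip (positions r) = π₂ n , at-positions r ∈s

      module _ (i : ℕ)
               (compatible : ∀ l → All (InRange f) l → ∃[ t ] All (λ i → p i t ≡ 0) (i ∷ l)) where

        g : ℕ → ℕ
        g zero    = i
        g (suc k) = f k

        old : List ℕ → List ℕ
        old []           = []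
        old (zero ∷ ks)  = old ks
        old (suc k ∷ ks) = f k ∷ old ks

        old-in-range : ∀ ks → All (InRange f) (old ks)
        old-in-range []           = []
        old-in-range (zero ∷ ks)  = old-in-range ks
        old-in-range (suc k ∷ ks) = (k , refl) ∷ old-in-range ks

        g-fip : HasFIP (λ k → 𝕏 (g k))
        g-fip ks with t , pit ∷ pt ← compatible (old ks) (old-in-range ks)
                    | j , i<j ∷ <j ← above (i ∷ old ks) = ⟨ j , t ⟩ , go ks pt <j
          where
          go : ∀ ks → All (λ i → p i t ≡ 0) (old ks) → All (_< j) (old ks) →
               All (λ k → 𝕏 (g k) ⟨ j , t ⟩ ≡ true) ks
          go []           _         _          = []
          go (zero ∷ ks)  ps        ks<j       = ∈-intro pit (>⇒≢ i<j) ∷ go ks ps ks<j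
          go (suc k ∷ ks) (pk ∷ ps) (k<j ∷ ks<j) = ∈-intro pk (>⇒≢ k<j) ∷ go ks ps ks<j

        -- Prepending `i` keeps the finite intersection property, so the set of `i` already occurs
        -- as that of some `f k`. If `f k` differed from `i`, an element in slice `f k` would lie in
        -- the former set but not in the latter.
        f-maximal : InRange f i
        f-maximal with em {FamSub (λ k → 𝕏 (g k)) (λ k → 𝕏 (f k))}
        ... | no ¬sub = contradiction g-fip (proj₂ fip g ((λ k → suc k , λ _ → refl) , ¬sub))
        ... | yes sub with k , same ← sub 0 with f k ≟ i
        ... | yes eq = k , eq
        ... | no neq with t , pit ∷ [] ← compatible [] [] =
          contradiction (π₁-⟨,⟩ (f k) t)
            (proj₂ (∈-elim (trans (sym (same ⟨ f k , t ⟩)) (∈-intro pit neq))))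

  maximal-enumeration : MaximalEnumeration X p
  maximal-enumeration with f , (e , r) , fip ← solve 𝕏 uniform nonempty = record
    { enum = f ; computes = computable e r
    ; consistent = f-consistent fip ; maximal = f-maximal fip }

-- Finite strings and initial segments

-- The number a codes the real whose initial segment is the string with code a, continued by
-- false; all finite strings arise in this way.

tail : ℕ → ℕ
tail a = π₂ (pred a)

drop : ℕ → ℕ → ℕ
drop = rec (λ a → a) (λ _ a _ → tail a)

nonzero : ℕ → Bool
nonzero zero    = false
nonzero (suc _) = true

ifz-nonzero : ∀ n → ifz n 0 1 ≡ bit (nonzero n)
ifz-nonzero zero    = refl
ifz-nonzero (suc n) = refl

-- Past the end of the string the reading is `false`: since `unpair 0` is `(0 , 0)`, both head and
-- tail of the code 0 are 0.
path : ℕ → Real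
path a i = nonzero (π₁ (pred (drop i a)))

-- `G ↾ n` grows at its right end while `codeStr` recurses from the left; this left-to-right form
-- mediates between them.
segment : Real → ℕ → ℕ → List Bool
segment α i zero    = []
segment α i (suc m) = α i ∷ segment α (suc i) m

segment-snoc : ∀ α i m → segment α i m ++ [ α (m + i) ] ≡ segment α i (suc m)
segment-snoc α i zero    = refl
segment-snoc α i (suc m) = cong (α i ∷_)
  (trans (cong (λ k → segment α (suc i) m ++ [ α k ]) (sym (+-suc m i))) (segment-snoc α (suc i) m))

↾≡segment : ∀ α n → α ↾ n ≡ segment α 0 n
↾≡segment α zero    = refl
↾≡segment α (suc n) = trans (cong (_++ [ α n ]) (↾≡segment α n))
  (trans (cong (λ k → segment α 0 n ++ [ α k ]) (sym (+-identityʳ n))) (segment-snoc α 0 n))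

-- The first bit is outermost in a code, so the recursion runs backwards: after j rounds the value
-- codes the last j of the `l` bits.
prefix-code : ℕ → ℕ → ℕ
prefix-code a l =
  rec (λ _ → 0) (λ j h y → suc ⟨ bit (path (π₁ y) (π₂ y ∸ suc j)) , h ⟩) l ⟨ a , l ⟩

prefix-code-≡ : ∀ a l → prefix-code a l ≡ codeStr (path a ↾ l)
prefix-code-≡ a l = trans (go l ≤-refl)
  (trans (cong (λ k → codeStr (segment (path a) k l)) (n∸n≡0 l))
         (cong codeStr (sym (↾≡segment (path a) l))))
  where
  s : ℕ → ℕ → ℕ → ℕ
  s j h y = suc ⟨ bit (path (π₁ y) (π₂ y ∸ suc j)) , h ⟩

  go : ∀ j → j ≤ l → rec (λ _ → 0) s j ⟨ a , l ⟩ ≡ codeStr (segment (path a) (l ∸ j) j)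
  go zero    _ = refl
  go (suc j) j<l rewrite go j (<⇒≤ j<l) | π₁-⟨,⟩ a l | π₂-⟨,⟩ a l
    | +-∸-assoc 1 j<l = cong suc (⟨,⟩≡pair _ _)

drop-tail : ∀ i a → drop i (tail a) ≡ tail (drop i a)
drop-tail zero    a = refl
drop-tail (suc i) a = cong tail (drop-tail i a)

nonzero-bit : ∀ b → nonzero (bit b) ≡ b
nonzero-bit true  = refl
nonzero-bit false = refl

module _ (b : Bool) (σ : List Bool) where

  path-code-zero : path (codeStr (b ∷ σ)) 0 ≡ b
  path-code-zero = trans
    (cong nonzero (trans (cong π₁ (sym (⟨,⟩≡pair (bit b) (codeStr σ)))) (π₁-⟨,⟩ (bit b) (codeStr σ))))
    (nonzero-bit b)

  path-code-suc : ∀ i → path (codeStr (b ∷ σ)) (suc i) ≡ path (codeStr σ) i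
  path-code-suc i = cong (λ a → nonzero (π₁ (pred a)))
    (trans (sym (drop-tail i (codeStr (b ∷ σ)))) (cong (drop i) tail-code))
    where
    tail-code : tail (codeStr (b ∷ σ)) ≡ codeStr σ
    tail-code = trans (cong π₂ (sym (⟨,⟩≡pair (bit b) (codeStr σ)))) (π₂-⟨,⟩ (bit b) (codeStr σ))

segment-cong : ∀ {α β} i k m → (∀ j → j < m → α (j + i) ≡ β (j + k)) →
               segment α i m ≡ segment β k m
segment-cong i k zero    _ = refl
segment-cong {α} {β} i k (suc m) eq = cong₂ _∷_ (eq 0 (s≤s z≤n))
  (segment-cong (suc i) (suc k) m λ j j<m →
    trans (cong α (+-suc j i)) (trans (eq (suc j) (s≤s j<m)) (cong β (sym (+-suc j k)))))

path-code-segment : ∀ σ → segment (path (codeStr σ)) 0 (length σ) ≡ σ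
path-code-segment []      = refl
path-code-segment (b ∷ σ) = cong₂ _∷_ (path-code-zero b σ)
  (trans (segment-cong 1 0 (length σ) λ j _ →
           trans (cong (path (codeStr (b ∷ σ))) (+-comm j 1))
                 (trans (path-code-suc b σ j) (cong (path (codeStr σ)) (sym (+-identityʳ j)))))
         (path-code-segment σ))

path-code-↾ : ∀ σ → path (codeStr σ) ↾ length σ ≡ σ
path-code-↾ σ = trans (↾≡segment _ (length σ)) (path-code-segment σ)

infix 4 _≈[_]_
_≈[_]_ : Real → ℕ → Real → Set
α ≈[ k ] β = ∀ n → n < k → α n ≡ β n

≈-trans : ∀ {α β γ k} → α ≈[ k ] β → β ≈[ k ] γ → α ≈[ k ] γ
≈-trans p q n n<k = trans (p n n<k) (q n n<k)

≈-sym : ∀ {α β k} → α ≈[ k ] β → β ≈[ k ] α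
≈-sym p n n<k = sym (p n n<k)

≈-weaken : ∀ {α β k l} → k ≤ l → α ≈[ l ] β → α ≈[ k ] β
≈-weaken k≤l p n n<k = p n (≤-trans n<k k≤l)

≈⇒↾≡ : ∀ {α β k} l → l ≤ k → α ≈[ k ] β → α ↾ l ≡ β ↾ l
≈⇒↾≡ zero    _   p = refl
≈⇒↾≡ (suc l) l<k p = cong₂ (λ σ b → σ ++ [ b ]) (≈⇒↾≡ l (<⇒≤ l<k) p) (p l l<k)

path-code-++ : ∀ α k ρ → path (codeStr (α ↾ k ++ ρ)) ≈[ k ] α
path-code-++ α k ρ n n<k rewrite ↾≡segment α k =
  trans (go k 0 n n<k) (cong α (+-identityʳ n))
  where
  go : ∀ k i n → n < k → path (codeStr (segment α i k ++ ρ)) n ≡ α (n + i)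
  go (suc k) i zero    _         = path-code-zero (α i) (segment α (suc i) k ++ ρ)
  go (suc k) i (suc n) (s≤s n<k) =
    trans (path-code-suc (α i) (segment α (suc i) k ++ ρ) n)
      (trans (go k (suc i) n n<k) (cong α (+-suc n i)))

code-↾-injective : ∀ {α β} k → codeStr (α ↾ k) ≡ codeStr (β ↾ k) → α ≈[ k ] β
code-↾-injective {α} {β} k eq n n<k rewrite ↾≡segment α k | ↾≡segment β k =
  subst (λ m → α m ≡ β m) (+-identityʳ n) (go k 0 eq n n<k)
  where
  go : ∀ k i → codeStr (segment α i k) ≡ codeStr (segment β i k) → ∀ n → n < k → α (n + i) ≡ β (n + i)
  go (suc k) i eq = λ
    { zero    _         → bit-injective (cong proj₁ eq′)
    ; (suc n) (s≤s n<k) → subst (λ m → α m ≡ β m) (+-suc n i) (go k (suc i) (cong proj₂ eq′) n n<k) }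
    where
    eq′ : (bit (α i) , codeStr (segment α (suc i) k)) ≡ (bit (β i) , codeStr (segment β (suc i) k))
    eq′ = trans (sym (unpair-pair _ _)) (trans (cong unpair (suc-injective eq)) (unpair-pair _ _))

module _ {O : Real} where

  comp-path : ∀ {f g} → Computable O f → Computable O g → Computable O (λ n → bit (path (f n) (g n)))
  comp-path {f} {g} cf cg =
    comp-ext (λ n → ifz-nonzero (π₁ (pred (drop (g n) (f n)))))
      (comp-ifz (comp-π₁ (comp-pred (comp-app₂ drop (comp-rec comp-id (comp-π₂ (comp-pred arg₂₁))) cg cf)))
                (comp-const 0) (comp-const 1))

  comp-prefix-code : Computable₂ O prefix-code
  comp-prefix-code =
    comp-app₂ (rec (λ _ → 0) (λ j h y → suc ⟨ bit (path (π₁ y) (π₂ y ∸ suc j)) , h ⟩))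
      (comp-rec (comp-const 0)
        (comp-suc (comp-⟨,⟩
          (comp-path (comp-π₁ arg₂₂) (comp-∸ (comp-π₂ arg₂₂) (comp-suc arg₁))) arg₂₁)))
      arg₂ (comp-⟨,⟩ arg₁ arg₂)

-- The sets of the family

Met : ℕ → Real → ℕ → Set
Met e α u = ∃[ l ] (l ≤ u × halt-value e (codeStr (α ↾ l)) u ≡ 0)

-- The one bound `u` limits the length of the prefix as well as the stage, so no bit from `u` on is
-- read.
met-local : ∀ {e α β u} → α ≈[ u ] β → Met e α u → Met e β u
met-local {e} {u = u} α≈β (l , l≤u , h) =
  l , l≤u , subst (λ σ → halt-value e (codeStr σ) u ≡ 0) (≈⇒↾≡ l l≤u α≈β) h

on-triple⁻ : ∀ f {a b c} → on-triple f ⟨ a , ⟨ b , c ⟩ ⟩ ≡ 0 → f a b c ≡ 0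
on-triple⁻ f {a} {b} {c} = trans (sym (on-triple-≡ f a b c))

on-triple⁺ : ∀ f {a b c} → f a b c ≡ 0 → on-triple f ⟨ a , ⟨ b , c ⟩ ⟩ ≡ 0
on-triple⁺ f {a} {b} {c} = trans (on-triple-≡ f a b c)

accepts : ℕ → ℕ → ℕ → ℕ → ℕ
accepts l e a u = halt-value e (prefix-code a l) u

opaque
  met : ℕ → ℕ → ℕ → ℕ
  met e a u = exists≤ (λ l → on-triple (accepts l)) u ⟨ e , ⟨ a , u ⟩ ⟩

  met-≡ : ∀ e a u → met e a u ≡ exists≤ (λ l → on-triple (accepts l)) u ⟨ e , ⟨ a , u ⟩ ⟩
  met-≡ e a u = refl

met-sound : ∀ e a u → met e a u ≡ 0 → Met e (path a) u
met-sound e a u eq with l , l≤u , h ← exists≤-elim u (trans (sym (met-≡ e a u)) eq) =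
  l , l≤u , subst (λ x → halt-value e x u ≡ 0) (prefix-code-≡ a l) (on-triple⁻ (accepts l) h)

met-complete : ∀ e a u → Met e (path a) u → met e a u ≡ 0
met-complete e a u (l , l≤u , h) = trans (met-≡ e a u) (exists≤-intro l l≤u
  (on-triple⁺ (accepts l) (subst (λ x → halt-value e x u ≡ 0) (sym (prefix-code-≡ a l)) h)))

-- `extends w x`: the path a′ extends the string of length s on the path a, and meets program n
-- by stage u, where w = ⟨ a′ , u ⟩ and x = ⟨ n , ⟨ a , s ⟩ ⟩.

extends-by : ℕ → ℕ → ℕ → ℕ → ℕ → ℕ
extends-by a′ u n a s = dist (prefix-code a s) (prefix-code a′ s) + met n a′ u

opaque
  extends : ℕ → ℕ → ℕ
  extends w x = on-triple (extends-by (π₁ w) (π₂ w)) x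

  extends-≡ : ∀ w x → extends w x ≡ on-triple (extends-by (π₁ w) (π₂ w)) x
  extends-≡ w x = refl

extends-sound : ∀ {n a s} w → extends w ⟨ n , ⟨ a , s ⟩ ⟩ ≡ 0 →
                path (π₁ w) ≈[ s ] path a × Met n (path (π₁ w)) (π₂ w)
extends-sound {n} {a} {s} w eq = agree , met-sound n a′ u (m+n≡0⇒n≡0 d eq′)
  where
  a′ = π₁ w
  u  = π₂ w
  d  = dist (prefix-code a s) (prefix-code a′ s)

  eq′ : extends-by a′ u n a s ≡ 0
  eq′ = on-triple⁻ (extends-by a′ u) (trans (sym (extends-≡ w _)) eq)

  agree : path a′ ≈[ s ] path a
  agree = code-↾-injective s (begin
    codeStr (path a′ ↾ s) ≡⟨ prefix-code-≡ a′ s ⟨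
    prefix-code a′ s      ≡⟨ dist≡0⇒≡ (prefix-code a s) (prefix-code a′ s) (m+n≡0⇒m≡0 d eq′) ⟨
    prefix-code a s       ≡⟨ prefix-code-≡ a s ⟩
    codeStr (path a ↾ s)  ∎)
    where open ≡-Reasoning

extends-complete : ∀ {n a s} a′ u → path a′ ≈[ s ] path a → Met n (path a′) u →
                   extends ⟨ a′ , u ⟩ ⟨ n , ⟨ a , s ⟩ ⟩ ≡ 0
extends-complete {n} {a} {s} a′ u a′≈a m =
  trans (extends-≡ ⟨ a′ , u ⟩ _) (on-triple⁺ (extends-by (π₁ ⟨ a′ , u ⟩) (π₂ ⟨ a′ , u ⟩)) eq)
  where
  eq : extends-by (π₁ ⟨ a′ , u ⟩) (π₂ ⟨ a′ , u ⟩) n a s ≡ 0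
  eq rewrite π₁-⟨,⟩ a′ u | π₂-⟨,⟩ a′ u | met-complete n a′ u m
           | prefix-code-≡ a s | prefix-code-≡ a′ s | ≈⇒↾≡ s ≤-refl a′≈a
           | dist-self (codeStr (path a ↾ s)) = refl

-- If x has no extension at all, Guarded e x amounts to Met e; otherwise it asks for an element
-- of a finite set of strings.

Guarded : ℕ → ℕ → Real → ℕ → Set
Guarded e x α s = ∃[ u ] (u ≤ s × Met e α u × (∀ w → w ≤ u → extends w x ≢ 0))

guarded-at : ℕ → ℕ → ℕ → ℕ → ℕ
guarded-at u e x a = met e a u + not (exists≤ extends u x)

opaque
  guarded : ℕ → ℕ → ℕ → ℕ → ℕ
  guarded e x a s = exists≤ (λ u → on-triple (guarded-at u)) s ⟨ e , ⟨ x , a ⟩ ⟩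

  guarded-≡ : ∀ e x a s → guarded e x a s ≡
              exists≤ (λ u → on-triple (guarded-at u)) s ⟨ e , ⟨ x , a ⟩ ⟩
  guarded-≡ e x a s = refl

guarded-sound : ∀ e x a s → guarded e x a s ≡ 0 → Guarded e x (path a) s
guarded-sound e x a s eq
  with u , u≤s , h ← exists≤-elim s (trans (sym (guarded-≡ e x a s)) eq)
  with h′ ← on-triple⁻ (guarded-at u) h =
  u , u≤s , met-sound e a u (m+n≡0⇒m≡0 (met e a u) h′) ,
  λ w w≤u ext → not≡0⇒≢0 (exists≤ extends u x) (m+n≡0⇒n≡0 (met e a u) h′) (exists≤-intro w w≤u ext)

guarded-complete : ∀ e x a s → Guarded e x (path a) s → guarded e x a s ≡ 0
guarded-complete e x a s (u , u≤s , m , guard) =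
  trans (guarded-≡ e x a s) (exists≤-intro u u≤s (on-triple⁺ (guarded-at u)
  (cong₂ _+_ (met-complete e a u m)
    (≢0⇒not≡0 _ λ eq → let w , w≤u , ext = exists≤-elim u eq in guard w w≤u ext))))

-- Every number is an index, so there are junk sets: a bit condition with `b` above 1 is empty, and
-- `e` may code no program. The argument tolerates these, as it uses only `halt-value` of `e`.
SatisfiesTag : ℕ → ℕ → ℕ → Real → ℕ → Set
SatisfiesTag zero    n b α s = bit (α n) ≡ b
SatisfiesTag (suc _) e x α s = Guarded e x α s

Satisfies : ℕ → Real → ℕ → Set
Satisfies i = SatisfiesTag (π₁ i) (π₁ (π₂ i)) (π₂ (π₂ i))

satisfies-tag : ℕ → ℕ → ℕ → ℕ → ℕ → ℕ
satisfies-tag t p q a s = ifz t (dist (bit (path a p)) q) (guarded p q a s)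

satisfies : ℕ → ℕ → ℕ
satisfies i z = satisfies-tag (π₁ i) (π₁ (π₂ i)) (π₂ (π₂ i)) (π₁ z) (π₂ z)

satisfies-sound : ∀ i z → satisfies i z ≡ 0 → Satisfies i (path (π₁ z)) (π₂ z)
satisfies-sound i z = go (π₁ i)
  where
  go : ∀ t {p q a s} → satisfies-tag t p q a s ≡ 0 → SatisfiesTag t p q (path a) s
  go zero    {p} {q} {a} {s} = dist≡0⇒≡ (bit (path a p)) q
  go (suc _) {p} {q} {a} {s} = guarded-sound p q a s

satisfies-complete : ∀ i z → Satisfies i (path (π₁ z)) (π₂ z) → satisfies i z ≡ 0
satisfies-complete i z = go (π₁ i)
  where
  go : ∀ t {p q a s} → SatisfiesTag t p q (path a) s → satisfies-tag t p q a s ≡ 0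
  go zero    {q = q} refl    = dist-self q
  go (suc _) {p} {q} {a} {s} = guarded-complete p q a s

-- Conditions are open in the real and persist in the stage: the witness `u` of a guarded set stays
-- admissible for larger stages and reads only bits below `u`.
satisfies-stable : ∀ i {α s} → Satisfies i α s →
                   ∃[ k ] (∀ {β s′} → β ≈[ k ] α → k ≤ s′ → Satisfies i β s′)
satisfies-stable i = go (π₁ i)
  where
  go : ∀ t {p q α s} → SatisfiesTag t p q α s →
       ∃[ k ] (∀ {β s′} → β ≈[ k ] α → k ≤ s′ → SatisfiesTag t p q β s′)
  go zero    {p} h = suc p , λ β≈α _ → trans (cong bit (β≈α p ≤-refl)) h
  go (suc _) (u , _ , m , guard) = u , λ β≈α u≤s′ → u , u≤s′ , met-local (≈-sym β≈α) m , guard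

bit-index : ℕ → Bool → ℕ
bit-index n b = ⟨ 0 , ⟨ n , bit b ⟩ ⟩

guard-index : ℕ → ℕ → ℕ
guard-index e x = ⟨ 1 , ⟨ e , x ⟩ ⟩

transport : {A B : Set} → A ≡ B → A → B
transport refl a = a

satisfies-bit : ∀ n b {α s} → Satisfies (bit-index n b) α s ≡ (bit (α n) ≡ bit b)
satisfies-bit n b
  rewrite π₁-⟨,⟩ 0 ⟨ n , bit b ⟩ | π₂-⟨,⟩ 0 ⟨ n , bit b ⟩ | π₁-⟨,⟩ n (bit b) | π₂-⟨,⟩ n (bit b) = refl

satisfies-guard : ∀ e x {α s} → Satisfies (guard-index e x) α s ≡ Guarded e x α s
satisfies-guard e x
  rewrite π₁-⟨,⟩ 1 ⟨ e , x ⟩ | π₂-⟨,⟩ 1 ⟨ e , x ⟩ | π₁-⟨,⟩ e x | π₂-⟨,⟩ e x = refl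

module _ {O : Real} where

  comp-met : ∀ {f g h} → Computable O f → Computable O g → Computable O h →
             Computable O (λ n → met (f n) (g n) (h n))
  comp-met {f} {g} {h} cf cg ch = comp-ext (λ n → sym (met-≡ (f n) (g n) (h n)))
    (comp-app₂ (exists≤ λ l → on-triple (accepts l))
      (comp-exists≤ (comp-app₃ halt-value comp-halt-value arg₂₁
        (comp-app₂ prefix-code comp-prefix-code (comp-π₁ arg₂₂) arg₁) (comp-π₂ arg₂₂)))
      ch (comp-⟨,⟩ cf (comp-⟨,⟩ cg ch)))

  comp-extends : Computable₂ O extends
  comp-extends = comp-ext (λ n → sym (extends-≡ (π₁ n) (π₂ n))) (comp-+
    (comp-dist (comp-app₂ prefix-code comp-prefix-code a s)
               (comp-app₂ prefix-code comp-prefix-code (comp-π₁ arg₁) s))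
    (comp-met arg₂₁ (comp-π₁ arg₁) (comp-π₂ arg₁)))
    where
    a = comp-π₁ arg₂₂
    s = comp-π₂ arg₂₂

  comp-guarded : ∀ {f g h k} → Computable O f → Computable O g → Computable O h → Computable O k →
                 Computable O (λ n → guarded (f n) (g n) (h n) (k n))
  comp-guarded {f} {g} {h} {k} cf cg ch ck =
    comp-ext (λ n → sym (guarded-≡ (f n) (g n) (h n) (k n)))
      (comp-app₂ (exists≤ λ u → on-triple (guarded-at u))
        (comp-exists≤ (comp-+ (comp-met arg₂₁ (comp-π₂ arg₂₂) arg₁)
          (comp-not (comp-app₂ (exists≤ extends) (comp-exists≤ comp-extends) arg₁ (comp-π₁ arg₂₂)))))
        ck (comp-⟨,⟩ cf (comp-⟨,⟩ cg ch)))

  comp-satisfies : Computable₂ O satisfies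
  comp-satisfies = comp-ifz (comp-π₁ arg₁)
    (comp-dist (comp-path (comp-π₁ arg₂) p) q) (comp-guarded p q (comp-π₁ arg₂) (comp-π₂ arg₂))
    where
    p = comp-π₁ (comp-π₂ arg₁)
    q = comp-π₂ (comp-π₂ arg₁)

satisfies-at : ∀ i a s → Satisfies i (path a) s → satisfies i ⟨ a , s ⟩ ≡ 0
satisfies-at i a s h = satisfies-complete i ⟨ a , s ⟩
  (subst₂ (λ a s → Satisfies i (path a) s) (sym (π₁-⟨,⟩ a s)) (sym (π₂-⟨,⟩ a s)) h)

module _ {V : List Bool → Set} {c : Code}
         (ce : ∀ σ → (V σ → ∅ ⊢ c ⇓ codeStr σ) × (∅ ⊢ c ⇓ codeStr σ → V σ)) where

  met⇒∈ : ∀ {α u} → Met ⌜ c ⌝ α u → ∃[ l ] (l ≤ u × V (α ↾ l))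
  met⇒∈ {α} {u} (l , l≤u , h) = l , l≤u , proj₂ (ce (α ↾ l)) (halts⇒⇓ c _ u h)

  ∈⇒met : ∀ {σ} → V σ → ∃[ k ] (∀ {s} → k ≤ s → Met ⌜ c ⌝ (path (codeStr σ)) s)
  ∈⇒met {σ} σ∈V with k , h ← ⇓⇒halts c (codeStr σ) (proj₁ (ce σ) σ∈V) =
    length σ ⊔ k , λ {s} le → length σ , ≤-trans (m≤m⊔n (length σ) k) le ,
      subst (λ τ → halt-value ⌜ c ⌝ (codeStr τ) s ≡ 0) (sym (path-code-↾ σ))
        (halt-value-mono ⌜ c ⌝ (codeStr σ) (≤-trans (m≤n⊔m (length σ) k) le) h)

-- A question about the looping program, hence with negative answer. As a guard it never interferes,
-- which puts the unrestricted c.e. sets among the candidates.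
hopeless : ℕ
hopeless = ⟨ ⟨ 14 , 0 ⟩ , ⟨ 0 , 0 ⟩ ⟩

hopeless-never-extends : ∀ w → extends w hopeless ≢ 0
hopeless-never-extends w eq with _ , l , _ , h ← extends-sound w eq = loop-never-halts _ (π₂ w) h

-- From a maximal family to a generic real

module _ {X : Real} (em : ExcludedMiddle 0ℓ) (M : MaximalEnumeration X satisfies) where

  open MaximalEnumeration M

  In : ℕ → Set
  In = InRange enum

  Joint : List ℕ → ℕ → Set
  Joint l z = All (λ i → satisfies i z ≡ 0) l

  refuted : ∀ {i} → ¬ In i → ∃[ l ] (All In l × (∀ z → ¬ Joint (i ∷ l) z))
  refuted {i} i∉ with em {∃[ l ] (All In l × (∀ z → ¬ Joint (i ∷ l) z))}
  ... | yes r = r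
  ... | no ¬r = contradiction (maximal i compatible) i∉
    where
    compatible : ∀ l → All In l → ∃[ z ] Joint (i ∷ l) z
    compatible l ∈l with em {∃[ z ] Joint (i ∷ l) z}
    ... | yes c = c
    ... | no ¬c = contradiction (l , ∈l , λ z h → ¬c (z , h)) ¬r

  bit-satisfied : ∀ n {b} z → path (π₁ z) n ≡ b → satisfies (bit-index n b) z ≡ 0
  bit-satisfied n z refl = satisfies-complete (bit-index n (path (π₁ z) n)) z
    (transport (sym (satisfies-bit n (path (π₁ z) n))) refl)

  bit-correct : ∀ n {b} z → satisfies (bit-index n b) z ≡ 0 → path (π₁ z) n ≡ b
  bit-correct n {b} z h =
    bit-injective (transport (satisfies-bit n b) (satisfies-sound (bit-index n b) z h))

  -- If both indices were missing, each would be blocked by a finite part of the family. The two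
  -- parts together have a common element, whose `n`-th bit has one of the two values and
  -- contradicts the corresponding block.
  some-bit : ∀ n → ∃[ b ] In (bit-index n b)
  some-bit n with em {In (bit-index n false)} | em {In (bit-index n true)}
  ... | yes ∈₀ | _      = false , ∈₀
  ... | no _   | yes ∈₁ = true , ∈₁
  ... | no ∉₀  | no ∉₁
    with l₀ , ∈l₀ , r₀ ← refuted ∉₀ | l₁ , ∈l₁ , r₁ ← refuted ∉₁
    with z , h ← consistent (l₀ ++ l₁) (++⁺ ∈l₀ ∈l₁)
    with path (π₁ z) n in eq
  ... | false = contradiction (bit-satisfied n z eq ∷ ++⁻ˡ l₀ h) (r₀ z)
  ... | true  = contradiction (bit-satisfied n z eq ∷ ++⁻ʳ l₀ h) (r₁ z)

  not-bit : ℕ → Bool → ℕ → ℕ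
  not-bit n b w = dist (enum w) (bit-index n b)

  bit-found : ∀ n b → In (bit-index n b) → ∃[ w ] not-bit n false w * not-bit n true w ≡ 0
  bit-found n false (w , eq) = w , cong (_* not-bit n true w) (≡⇒dist≡0 eq)
  bit-found n true  (w , eq) =
    w , trans (cong (not-bit n false w *_) (≡⇒dist≡0 eq)) (*-zeroʳ (not-bit n false w))

  comp-not-bit : ∀ b {f g} → Computable X f → Computable X g →
                 Computable X (λ n → not-bit (f n) b (g n))
  comp-not-bit b cf cg =
    comp-dist (comp-∘ computes cg) (comp-⟨,⟩ (comp-const 0) (comp-⟨,⟩ cf (comp-const (bit b))))

  finder : ∃[ h ] (Computable X h × (∀ n → not-bit n false (h n) * not-bit n true (h n) ≡ 0))
  finder = comp-min {p = λ w n → not-bit n false w * not-bit n true w}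
     (comp-* (comp-not-bit false arg₂ arg₁) (comp-not-bit true arg₂ arg₁))
     (λ n → bit-found n (proj₁ (some-bit n)) (proj₂ (some-bit n)))

  find : ℕ → ℕ
  find = proj₁ finder

  limit : Real
  limit n = nonzero (not-bit n false (find n))

  comp-limit : ComputesReal X limit
  comp-limit = computes-fun c
    where
    c : Computable X (λ n → bit (limit n))
    c = comp-ext (λ n → ifz-nonzero (not-bit n false (find n)))
      (comp-ifz (comp-not-bit false comp-id (proj₁ (proj₂ finder))) (comp-const 0) (comp-const 1))

  limit-in : ∀ n → In (bit-index n (limit n))
  limit-in n with m*n≡0⇒m≡0∨n≡0 (not-bit n false (find n)) (proj₂ (proj₂ finder) n)
  ... | inj₁ eq rewrite eq = find n , dist≡0⇒≡ _ _ eq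
  ... | inj₂ eq with not-bit n false (find n) in eq′
  ... | zero  = find n , dist≡0⇒≡ _ _ eq′
  ... | suc _ = find n , dist≡0⇒≡ _ _ eq

  limit-bits : ℕ → List ℕ
  limit-bits zero    = []
  limit-bits (suc k) = bit-index k (limit k) ∷ limit-bits k

  limit-bits-in : ∀ k → All In (limit-bits k)
  limit-bits-in zero    = []
  limit-bits-in (suc k) = limit-in k ∷ limit-bits-in k

  limit-bits-≈ : ∀ k {z} → Joint (limit-bits k) z → path (π₁ z) ≈[ k ] limit
  limit-bits-≈ (suc k) {z} (h ∷ hs) n n<1+k with m≤n⇒m<n∨m≡n (≤-pred n<1+k)
  ... | inj₁ n<k  = limit-bits-≈ k hs n n<k
  ... | inj₂ refl = bit-correct n z h

  -- The sets asking for the first `k` bits of the limit belong to the family themselves and can be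
  -- added to `l`.
  joint-near-limit : ∀ k l → All In l → ∃[ z ] (path (π₁ z) ≈[ k ] limit × Joint l z)
  joint-near-limit k l ∈l with z , h ← consistent (limit-bits k ++ l) (++⁺ (limit-bits-in k) ∈l) =
    z , limit-bits-≈ k (++⁻ˡ (limit-bits k) h) , ++⁻ʳ (limit-bits k) h

  -- If every set of the maximal family is met by the limit, the family can be extended by any
  -- c.e. set that is dense along the limit.
  module _ (all-met : ∀ i → In i → ∃[ s ] Satisfies i limit s) where

    all-stable : ∀ l → All In l →
                 ∃[ k ] (∀ {β s} → β ≈[ k ] limit → k ≤ s → All (λ i → Satisfies i β s) l)
    all-stable []      []        = 0 , λ _ _ → []
    all-stable (i ∷ l) (∈i ∷ ∈l)
      with k , h ← satisfies-stable i (proj₂ (all-met i ∈i)) | k′ , h′ ← all-stable l ∈l =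
      k ⊔ k′ , λ β≈limit le →
        h (≈-weaken (m≤m⊔n k k′) β≈limit) (≤-trans (m≤m⊔n k k′) le) ∷
        h′ (≈-weaken (m≤n⊔m k k′) β≈limit) (≤-trans (m≤n⊔m k k′) le)

    limit-generic : Cohen1Generic limit
    limit-generic V (c , ce)
      with em {∃[ k ] V (limit ↾ k)} | em {∃[ k ] (∀ ρ → ¬ V (limit ↾ k ++ ρ))}
    ... | yes (k , ∈V) | _            = limit ↾ k , (k , refl) , inj₁ ∈V
    ... | no _         | yes (k , ∉V) = limit ↾ k , (k , refl) , inj₂ ∉V
    ... | no unmet     | no ¬avoided  = contradiction limit-met
      λ { (_ , _ , _ , m , _) → unmet (let l , _ , ∈V = met⇒∈ ce m in l , ∈V) }
      where
      j = guard-index ⌜ c ⌝ hopeless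

      dense : ∀ k → ∃[ ρ ] V (limit ↾ k ++ ρ)
      dense k with em {∃[ ρ ] V (limit ↾ k ++ ρ)}
      ... | yes d = d
      ... | no ¬d = contradiction (k , λ ρ ∈V → ¬d (ρ , ∈V)) ¬avoided

      compatible : ∀ l → All In l → ∃[ z ] Joint (j ∷ l) z
      compatible l ∈l
        -- All conditions of `l` hold on any real that agrees with the limit below `k`, so the first
        -- `k` bits may be continued into `V` without losing them.
        with k , stable ← all-stable l ∈l
        with ρ , ∈V ← dense k
        with k′ , m ← ∈⇒met ce ∈V =
        ⟨ a , s ⟩ ,
        satisfies-at j a s (transport (sym (satisfies-guard ⌜ c ⌝ hopeless))
          (s , ≤-refl , m (m≤n⊔m k k′) , λ w _ → hopeless-never-extends w)) ∷
        All.map (λ {i} → satisfies-at i a s) (stable (path-code-++ limit k ρ) (m≤m⊔n k k′))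
        where
        a = codeStr (limit ↾ k ++ ρ)
        s = k ⊔ k′

      limit-met : ∃[ s ] Guarded ⌜ c ⌝ hopeless limit s
      limit-met = let s , h = all-met j (maximal j compatible) in
        s , transport (satisfies-guard ⌜ c ⌝ hopeless) h

  -- Otherwise the family contains some Guarded e x that is not met by the limit. It then
  -- contains Guarded e x′ exactly if x′ has no extension at all, so that X can recognize this
  -- and carry out a finite extension argument.
  module _ {i} (∈i : In i) (unmet : ∀ s → ¬ Satisfies i limit s) where

    -- An unmet index cannot be a bit condition: a common element agreeing with the limit at that
    -- bit satisfies the condition, and so the limit would too.
    guard-of : ∃[ e ] ∃[ x ] (∀ α s → Satisfies i α s ≡ Guarded e x α s)
    guard-of = go (π₁ i) refl
      where
      p = π₁ (π₂ i)
      q = π₂ (π₂ i)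
      go : ∀ t → π₁ i ≡ t → ∃[ e ] ∃[ x ] (∀ α s → Satisfies i α s ≡ Guarded e x α s)
      go (suc _) eq = p , q , λ α s → cong (λ t → SatisfiesTag t p q α s) eq
      go zero eq with z , z≈limit , h ∷ [] ← joint-near-limit (suc (π₁ (π₂ i))) (i ∷ []) (∈i ∷ []) =
        contradiction
          (transport (sym (at-tag limit 0))
            (trans (cong bit (sym (z≈limit _ ≤-refl)))
                   (transport (at-tag (path (π₁ z)) (π₂ z)) (satisfies-sound i z h))))
          (unmet 0)
        where
        at-tag : ∀ α s → Satisfies i α s ≡ SatisfiesTag 0 (π₁ (π₂ i)) (π₂ (π₂ i)) α s
        at-tag α s = cong (λ t → SatisfiesTag t (π₁ (π₂ i)) (π₂ (π₂ i)) α s) eq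

    e x : ℕ
    e = proj₁ guard-of
    x = proj₁ (proj₂ guard-of)

    is-guard : ∀ α s → Satisfies i α s ≡ Guarded e x α s
    is-guard = proj₂ (proj₂ guard-of)

    -- A witness `w` lets the guard pass only stages below `w`. An element of the set agreeing with
    -- the limit on `w` bits therefore transfers its membership to the limit. Applied to `i` itself
    -- and to the other sets guarding `e`.
    extendible⇒guarded : ∀ {j x′ w} → In j → (∀ α s → Satisfies j α s ≡ Guarded e x′ α s) →
                         extends w x′ ≡ 0 → ∃[ s ] Guarded e x′ limit s
    extendible⇒guarded {j} {x′} {w} ∈j eq ext
      with z , z≈limit , h ∷ [] ← joint-near-limit w (j ∷ []) (∈j ∷ [])
      with u , u≤s , m , guard ← transport (eq _ _) (satisfies-sound j z h) =
      u , u , ≤-refl , met-local (≈-weaken u≤w z≈limit) m , guard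
      where
      u≤w : u ≤ w
      u≤w = ≮⇒≥ λ w<u → guard w (<⇒≤ w<u) ext

    never-extends : ∀ w → extends w x ≢ 0
    never-extends w ext with s , g ← extendible⇒guarded ∈i is-guard ext =
      unmet s (transport (sym (is-guard limit s)) g)

    never-met : ∀ u → ¬ Met e limit u
    never-met u m = unmet u (transport (sym (is-guard limit u))
      (u , ≤-refl , m , λ w _ → never-extends w))

    in⇒never-extends : ∀ {x′} → In (guard-index e x′) → ∀ w → extends w x′ ≢ 0
    in⇒never-extends {x′} ∈j w ext
      with s , u , _ , m , _ ← extendible⇒guarded ∈j (λ α s → satisfies-guard e x′) ext =
      never-met u m

    -- The guard is void, so the new set contains that of `i`; common elements with `i` already
    -- witness compatibility.
    never-extends⇒in : ∀ {x′} → (∀ w → extends w x′ ≢ 0) → In (guard-index e x′)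
    never-extends⇒in {x′} never = maximal (guard-index e x′) compatible
      where
      compatible : ∀ l → All In l → ∃[ z ] Joint (guard-index e x′ ∷ l) z
      compatible l ∈l with z , h ∷ hs ← consistent (i ∷ l) (∈i ∷ ∈l)
        with u , u≤s , m , _ ← transport (is-guard _ _) (satisfies-sound i z h) =
        z , satisfies-complete (guard-index e x′) z (transport (sym (satisfies-guard e x′))
              (u , u≤s , m , λ w _ → never w)) ∷ hs

    -- The same `w` is tried as an extension and as a place in `enum`; one of the two must succeed,
    -- so a single search settles the question.
    decides : ℕ → ℕ → ℕ
    decides w x′ = extends w x′ * dist (enum w) (guard-index e x′)

    decided : ∀ x′ → ∃[ w ] decides w x′ ≡ 0
    decided x′ with em {∃[ w ] extends w x′ ≡ 0}
    ... | yes (w , ext) = w , cong (_* dist (enum w) (guard-index e x′)) ext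
    ... | no ¬ext with w , eq ← never-extends⇒in (λ w ext → ¬ext (w , ext)) =
      w , trans (cong (extends w x′ *_) (≡⇒dist≡0 eq)) (*-zeroʳ (extends w x′))

    opaque
      decider : ∃[ h ] (Computable X h × (∀ x′ → decides (h x′) x′ ≡ 0))
      decider = comp-min {p = decides}
        (comp-* comp-extends
          (comp-dist (comp-∘ computes arg₁) (comp-⟨,⟩ (comp-const 1) (comp-⟨,⟩ (comp-const e) arg₂))))
        decided

    decision : ℕ → ℕ
    decision = proj₁ decider

    -- After an extension, `s + π₂ w` bits cover the prefix of length at most `π₂ w` that was
    -- accepted. The successor makes the length grow in both branches, so that the construction
    -- determines every bit.
    next-from : ℕ → ℕ → ℕ → ℕ → ℕ
    next-from w n a s =
      ifz (extends w ⟨ n , ⟨ a , s ⟩ ⟩) ⟨ π₁ w , suc (s + π₂ w) ⟩ ⟨ a , suc s ⟩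

    next : ℕ → ℕ → ℕ
    next n z = next-from (decision ⟨ n , ⟨ π₁ z , π₂ z ⟩ ⟩) n (π₁ z) (π₂ z)

    state : ℕ → ℕ
    state n = rec (λ _ → ⟨ 0 , 0 ⟩) (λ n z _ → next n z) n 0

    real : ℕ → Real
    real n = path (π₁ (state n))

    len : ℕ → ℕ
    len n = π₂ (state n)

    position : ℕ → ℕ
    position n = ⟨ n , ⟨ π₁ (state n) , len n ⟩ ⟩

    state-extended : ∀ n → extends (decision (position n)) (position n) ≡ 0 →
                     state (suc n) ≡
                     ⟨ π₁ (decision (position n)) , suc (len n + π₂ (decision (position n))) ⟩
    state-extended n ext rewrite ext = refl

    state-suc : ∀ n → real (suc n) ≈[ len n ] real n × len n < len (suc n)
    state-suc n with extends (decision (position n)) (position n) in ext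
    ... | zero
      rewrite π₁-⟨,⟩ (π₁ (decision (position n))) (suc (len n + π₂ (decision (position n))))
            | π₂-⟨,⟩ (π₁ (decision (position n))) (suc (len n + π₂ (decision (position n)))) =
      proj₁ (extends-sound (decision (position n)) ext) , s≤s (m≤m+n (len n) _)
    ... | suc _ rewrite π₁-⟨,⟩ (π₁ (state n)) (suc (len n)) | π₂-⟨,⟩ (π₁ (state n)) (suc (len n)) =
      (λ _ _ → refl) , ≤-refl

    n≤len : ∀ n → n ≤ len n
    n≤len zero    = z≤n
    n≤len (suc n) = ≤-trans (s≤s (n≤len n)) (proj₂ (state-suc n))

    real-≈ : ∀ {m n} → m ≤′ n → real n ≈[ len m ] real m × len m ≤ len n
    real-≈ ≤′-refl = (λ _ _ → refl) , ≤-refl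
    real-≈ (≤′-step {n} m≤n) with α≈ , le ← real-≈ m≤n | β≈ , lt ← state-suc n =
      ≈-trans (≈-weaken le β≈) α≈ , ≤-trans le (<⇒≤ lt)

    -- After `suc k` rounds the length exceeds `k`, so bit `k` is final.
    generic : Real
    generic k = real (suc k) k

    generic-≈ : ∀ n → generic ≈[ len n ] real n
    generic-≈ n k k<len with ≤-total n (suc k)
    ... | inj₁ n≤1+k = proj₁ (real-≈ (≤⇒≤′ n≤1+k)) k k<len
    ... | inj₂ 1+k≤n = sym (proj₁ (real-≈ (≤⇒≤′ 1+k≤n)) k (n≤len (suc k)))

    comp-generic : ComputesReal X generic
    comp-generic = computes-fun c
      where
      comp-next : Computable₃ X (λ n z _ → next n z)
      comp-next = comp-ifz
        (comp-app₂ extends comp-extends w x′)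
        (comp-⟨,⟩ (comp-π₁ w) (comp-suc (comp-+ s (comp-π₂ w))))
        (comp-⟨,⟩ a (comp-suc s))
        where
        a = comp-π₁ arg₂₁
        s = comp-π₂ arg₂₁
        x′ = comp-⟨,⟩ arg₁ (comp-⟨,⟩ a s)
        w = comp-∘ (proj₁ (proj₂ decider)) x′

      c : Computable X (λ k → bit (generic k))
      c = comp-path (comp-π₁ (comp-app₂ (rec (λ _ → ⟨ 0 , 0 ⟩) (λ n z _ → next n z))
            (comp-rec (comp-const ⟨ 0 , 0 ⟩) comp-next) (comp-suc comp-id) (comp-const 0))) comp-id

    module _ {V : List Bool → Set} {c : Code}
             (ce : ∀ σ → (V σ → ∅ ⊢ c ⇓ codeStr σ) × (∅ ⊢ c ⇓ codeStr σ → V σ)) where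

      private
        n = ⌜ c ⌝
        w = decision (position n)
        s = len n + π₂ w

      generic-meets : extends w (position n) ≡ 0 → ∃[ τ ] (τ ≺ generic × V τ)
      generic-meets ext with l , l≤u , ∈V ← met⇒∈ ce (proj₂ (extends-sound w ext)) =
        generic ↾ l , (l , refl) , subst V (sym (≈⇒↾≡ l l≤s generic≈)) ∈V
        where
        l≤s : l ≤ suc s
        l≤s = m≤n⇒m≤1+n (≤-trans l≤u (m≤n+m (π₂ w) (len n)))

        state≡ = state-extended n ext

        generic≈ : generic ≈[ suc s ] path (π₁ w)
        generic≈ = subst₂ (λ k a → generic ≈[ k ] path a)
          (trans (cong π₂ state≡) (π₂-⟨,⟩ (π₁ w) (suc s)))
          (trans (cong π₁ state≡) (π₁-⟨,⟩ (π₁ w) (suc s))) (generic-≈ (suc n))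

      -- The generic real agrees with the `n`-th approximation below `len n`, so a string of `V`
      -- extending that prefix would answer the question `position n` positively.
      generic-avoids : In (guard-index e (position n)) → ∀ ρ → ¬ V (generic ↾ len n ++ ρ)
      generic-avoids ∈j ρ ∈V with k , m ← ∈⇒met ce ∈V =
        in⇒never-extends ∈j ⟨ codeStr (generic ↾ len n ++ ρ) , k ⟩
          (extends-complete _ k (≈-trans (path-code-++ generic (len n) ρ) (generic-≈ n)) (m ≤-refl))

    generic-generic : Cohen1Generic generic
    generic-generic V (c , ce)
      with m*n≡0⇒m≡0∨n≡0 (extends (decision (position ⌜ c ⌝)) (position ⌜ c ⌝))
                         (proj₂ (proj₂ decider) (position ⌜ c ⌝))
    ... | inj₁ ext with τ , τ≺ , ∈V ← generic-meets ce ext = τ , τ≺ , inj₁ ∈V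
    ... | inj₂ eq  = generic ↾ len ⌜ c ⌝ , (len ⌜ c ⌝ , refl) ,
      inj₂ (generic-avoids ce (decision (position ⌜ c ⌝) , dist≡0⇒≡ _ _ eq))

mainTheorem2 : ExcludedMiddle 0ℓ → (X : Real) →
    (∀ (𝕏 : ℕ → Real) → UniformlyComputable 𝕏 → NotAllEmpty 𝕏 →
    ∃[ f ] (ComputesFun X f × IsFIP 𝕏 f)) →
    ∃[ G ] (ComputesReal X G × Cohen1Generic G)
mainTheorem2 em X solve = by-cases (maximal-enumeration em solve comp-satisfies
    -- Not all sets are empty: the real coded by 0 satisfies the condition asking for its own bit 0.
    {bit-index 0 (path 0 0)} {⟨ 0 , 0 ⟩}
    (satisfies-at (bit-index 0 (path 0 0)) 0 0
      (transport (sym (satisfies-bit 0 (path 0 0) {s = 0})) refl)))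
  where
  by-cases : MaximalEnumeration X satisfies → ∃[ G ] (ComputesReal X G × Cohen1Generic G)
  by-cases M with em {∃[ i ] (In em M i × (∀ s → ¬ Satisfies i (limit em M) s))}
  ... | yes (i , ∈i , unmet) =
    generic em M ∈i unmet , comp-generic em M ∈i unmet , generic-generic em M ∈i unmet
  ... | no ¬unmet = limit em M , comp-limit em M , limit-generic em M all-met
    where
    all-met : ∀ i → In em M i → ∃[ s ] Satisfies i (limit em M) s
    all-met i ∈i with em {∃[ s ] Satisfies i (limit em M) s}
    ... | yes h = h
    ... | no ¬h = contradiction (i , ∈i , λ s h → ¬h (s , h)) ¬unmet
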